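{- Let $a=(a_k)_{k\ge1}$ be a sequence of complex numbers with $a_1=0$, let $\lambda$ be a strict partition with $\ell(\lambda)=l$, and let $n\ge l$. Let $A_0(x_1,\dots,x_n)$ be the skew-symmetric $n\times n$ matrix $\left(\frac{x_i-x_j}{x_i+x_j}\right)_{1\le i,j\le n}$ and $B_\lambda(x_1,\dots,x_n)$ the $n\times l$ matrix $\left((x_i\mid a)^{\lambda_{l+1-j}}\right)_{1\le i\le n,\,1\le j\le l}$. Let $A_\lambda(x_1,\dots,x_n)$ be the skew-symmetric $(n+l)\times(n+l)$ matrix $$\begin{pmatrix}A_0(x_1,\dots,x_n)&B_\lambda(x_1,\dots,x_n)\\-B_\lambda(x_1,\dots,x_n)^t&0\end{pmatrix}.$$ Put $\operatorname{Pf}_0(x_1,\dots,x_n)=\operatorname{Pf}(A_0(x_1,\dots,x_n))$ if $n$ is even and $\operatorname{Pf}(A_0(x_1,\dots,x_n,0))$ if $n$ is odd; put $\operatorname{Pf}_\lambda(x_1,\dots,x_n)=\operatorname{Pf}(A_\lambda(x_1,\dots,x_n))$ if $n+l$ is even and $\operatorname{Pf}(A_\lambda(x_1,\dots,x_n,0))$ if $n+l$ is odd. Then $$P_{\lambda;a}(x_1,\dots,x_n)=\frac{\operatorname{Pf}_\lambda(x_1,\dots,x_n)}{\operatorname{Pf}_0(x_1,\dots,x_n)}.$$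
   Context: A strict partition is $\lambda=(\lambda_1>\dots>\lambda_l>0)$, $\ell(\lambda)=l$. Put $(x\mid a)^k=\prod_{m=1}^k(x-a_m)$, $(x\mid a)^0=1$. For $\ell(\lambda)=l\le n$, $$P_{\lambda;a}(x_1,\dots,x_n)=\frac1{(n-l)!}\sum_{\omega\in S(n)}\prod_{i=1}^l (x_{\omega(i)}\mid a)^{\lambda_i}\prod_{1\le i\le l,\ i<j\le n}\frac{x_{\omega(i)}+x_{\omega(j)}}{x_{\omega(i)}-x_{\omega(j)}}$$ (a polynomial, the multiparameter Schur P-function). The Pfaffian of a skew-symmetric $2m\times2m$ matrix $A=(a_{ij})$ is $\operatorname{Pf}(A)=\sum_{\omega}\operatorname{sgn}(\omega)\prod_{i=1}^m a_{\omega(2i-1)\omega(2i)}$, summed over $\omega\in S(2m)$ with $\omega(2i-1)<\omega(2i)$ for all $i$ and $\omega(1)<\omega(3)<\dots<\omega(2m-1)$. Diagonal entries of $A_0$ are $0$; when a variable $0$ is appended, the corresponding entries are computed by the same formulas with that variable equal to $0$ (so $\frac{x_i-0}{x_i+0}=1$). The identity is one of rational functions in $x_1,\dots,x_n$. -}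

module Defs where

open import Level using (Level; _⊔_) renaming (suc to lsuc)
open import Data.Bool.Base using (Bool; true; false; if_then_else_; not; _∨_; _∧_)
open import Data.Nat.Base as ℕ using (ℕ; zero; suc; _∸_; _!; _<ᵇ_; _≤_)
open import Data.Fin.Base using (Fin; zero; suc; toℕ; inject≤; splitAt; opposite)
open import Data.Fin.Properties using (_≟_)
open import Data.Sum.Base using (inj₁; inj₂)
open import Data.Product.Base using (_×_; _,_)
open import Data.List.Base using (List; []; _∷_; map; foldr; allFin; concatMap; filterᵇ; length; cartesianProduct)
open import Relation.Nullary.Decidable.Core using (does)
open import Relation.Nullary.Negation.Core using (¬_)
open import Algebra.Bundles using (CommutativeRing)

-- A field of characteristic zero (stands in for ℂ, which agda-stdlib
-- does not provide).  The inverse is a total function; only its values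
-- at non-zero arguments are constrained (junk value at 0).

ℕ→R : ∀ {c ℓ} (R : CommutativeRing c ℓ) → ℕ → CommutativeRing.Carrier R
ℕ→R R zero    = CommutativeRing.0# R
ℕ→R R (suc k) = CommutativeRing._+_ R (CommutativeRing.1# R) (ℕ→R R k)

record CharZeroField (c ℓ : Level) : Set (lsuc (c ⊔ ℓ)) where
  field
    commutativeRing : CommutativeRing c ℓ
  open CommutativeRing commutativeRing public
  field
    _⁻¹        : Carrier → Carrier
    ⁻¹-cong    : ∀ {x y} → x ≈ y → x ⁻¹ ≈ y ⁻¹
    ⁻¹-inverse : ∀ x → ¬ (x ≈ 0#) → x * (x ⁻¹) ≈ 1#

  field
    charZero : ∀ k → ¬ (ℕ→R commutativeRing (suc k) ≈ 0#)

  ℕ→K : ℕ → Carrier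
  ℕ→K = ℕ→R commutativeRing

isEven : ℕ → Bool
isEven zero          = true
isEven (suc zero)    = false
isEven (suc (suc n)) = isEven n

_==ᶠ_ : ∀ {n} → Fin n → Fin n → Bool
i ==ᶠ j = does (i ≟ j)

_<ᶠ_ : ∀ {n} → Fin n → Fin n → Bool
i <ᶠ j = toℕ i <ᵇ toℕ j

allB : ∀ {A : Set} → (A → Bool) → List A → Bool
allB p xs = foldr _∧_ true (map p xs)

allMaps : (m n : ℕ) → List (Fin m → Fin n)
allMaps zero    n = (λ ()) ∷ []
allMaps (suc m) n =
  concatMap (λ f → map (λ k → λ { zero → k ; (suc i) → f i }) (allFin n)) (allMaps m n)

isInjective : ∀ {n} → (Fin n → Fin n) → Bool
isInjective {n} f =
  allB (λ i → allB (λ j → not (f i ==ᶠ f j) ∨ (i ==ᶠ j)) (allFin n)) (allFin n)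

perms : (n : ℕ) → List (Fin n → Fin n)
perms n = filterᵇ isInjective (allMaps n n)

inversions : ∀ {n} → (Fin n → Fin n) → ℕ
inversions {n} ω =
  length (filterᵇ (λ { (i , j) → (i <ᶠ j) ∧ (ω j <ᶠ ω i) })
                  (cartesianProduct (allFin n) (allFin n)))

pairs : ∀ {A : Set} → List A → List (A × A)
pairs (a ∷ b ∷ rest) = (a , b) ∷ pairs rest
pairs _              = []

firstsIncreasing : ∀ {n} → List (Fin n × Fin n) → Bool
firstsIncreasing ((a , _) ∷ ((c , d) ∷ rest)) =
  (a <ᶠ c) ∧ firstsIncreasing ((c , d) ∷ rest)
firstsIncreasing _ = true

pfAdmissible : ∀ {n} → (Fin n → Fin n) → Bool
pfAdmissible {n} ω =
  allB (λ { (a , b) → a <ᶠ b }) (pairs (map ω (allFin n)))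
  ∧ firstsIncreasing (pairs (map ω (allFin n)))

module FieldDefs {c ℓ : Level} (F : CharZeroField c ℓ) where
  open CharZeroField F using (Carrier; _≈_; _+_; _*_; -_; _-_; 0#; 1#; _⁻¹; ℕ→K)

  _/_ : Carrier → Carrier → Carrier
  x / y = x * (y ⁻¹)

  sumL : List Carrier → Carrier
  sumL = foldr _+_ 0#

  prodL : List Carrier → Carrier
  prodL = foldr _*_ 1#

  sgn : ∀ {n} → (Fin n → Fin n) → Carrier
  sgn ω = if isEven (inversions ω) then 1# else - 1#

  -- Pfaffian of an N×N matrix (meaningful for even N, where it is the
  -- sum over ω ∈ S(N) with ω(2i-1)<ω(2i), ω(1)<ω(3)<…; only used at even N)
  Pf : (N : ℕ) → (Fin N → Fin N → Carrier) → Carrier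
  Pf N M =
    sumL (map (λ ω → sgn ω * prodL (map (λ { (a , b) → M a b }) (pairs (map ω (allFin N)))))
              (filterᵇ pfAdmissible (perms N)))

  fpow : (ℕ → Carrier) → Carrier → ℕ → Carrier
  fpow a x zero    = 1#
  fpow a x (suc k) = fpow a x k * (x - a (suc k))

  append0 : ∀ {n} → (Fin n → Carrier) → Fin (suc n) → Carrier
  append0 {zero}  x _       = 0#
  append0 {suc n} x zero    = x zero
  append0 {suc n} x (suc i) = append0 (λ j → x (suc j)) i

  A0 : ∀ {N} → (Fin N → Carrier) → Fin N → Fin N → Carrier
  A0 x i j = if i ==ᶠ j then 0# else (x i - x j) / (x i + x j)

  Bλ : (ℕ → Carrier) → ∀ {l} → (Fin l → ℕ) → ∀ {N} → (Fin N → Carrier)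
     → Fin N → Fin l → Carrier
  Bλ a λ' x i j = fpow a (x i) (λ' (opposite j))

  Aλ : (ℕ → Carrier) → ∀ {l} → (Fin l → ℕ) → ∀ N → (Fin N → Carrier)
     → Fin (N ℕ.+ l) → Fin (N ℕ.+ l) → Carrier
  Aλ a λ' N x p q with splitAt N p | splitAt N q
  ... | inj₁ i | inj₁ j = A0 x i j
  ... | inj₁ i | inj₂ j = Bλ a λ' x i j
  ... | inj₂ i | inj₁ j = - Bλ a λ' x j i
  ... | inj₂ i | inj₂ j = 0#

  Pf₀ : ∀ n → (Fin n → Carrier) → Carrier
  Pf₀ n x = if isEven n then Pf n (A0 x) else Pf (suc n) (A0 (append0 x))

  Pfλ : (ℕ → Carrier) → ∀ {l} → (Fin l → ℕ) → ∀ n → (Fin n → Carrier) → Carrier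
  Pfλ a {l} λ' n x =
    if isEven (n ℕ.+ l) then Pf (n ℕ.+ l) (Aλ a λ' n x)
    else Pf (suc n ℕ.+ l) (Aλ a λ' (suc n) (append0 x))

  -- multiparameter Schur P-function P_{λ;a}(x_1,…,x_n), ℓ(λ) = l ≤ n
  -- (λ_{i+1} is  λ' i  for i : Fin l)
  SchurP : (ℕ → Carrier) → ∀ {l} → (Fin l → ℕ) → ∀ n → .(l ≤ n)
         → (Fin n → Carrier) → Carrier
  SchurP a {l} λ' n l≤n x =
    (ℕ→K ((n ∸ l) !)) ⁻¹ *
    sumL (map (λ ω →
      prodL (map (λ i →
        let ι = inject≤ i l≤n in
        fpow a (x (ω ι)) (λ' i) *
        prodL (map (λ j → (x (ω ι) + x (ω j)) / (x (ω ι) - x (ω j)))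
                   (filterᵇ (λ j → ι <ᶠ j) (allFin n))))
        (allFin l)))
      (perms n))

IsStrictPartition : ∀ {l} → (Fin l → ℕ) → Set
IsStrictPartition {l} λ' =
  (∀ (i j : Fin l) → toℕ i ℕ.< toℕ j → λ' j ℕ.< λ' i) × (∀ i → 0 ℕ.< λ' i)

{-# OPTIONS --safe #-}

-- Schur's evaluation Pf((x_i − x_j)/(x_i + x_j)) = ∏_{i<j} (x_i − x_j)/(x_i + x_j)
-- turns the expansion of Pf_λ along the column of λ_1 into the recursion
--   P_λ(x) = Σ_i (x_i | a)^{λ_1} ∏_{j≠i} (x_i + x_j)/(x_i − x_j) P_{λ∖λ_1}(x∖x_i),
-- because deleting x_i divides Schur's product by
-- ± ∏_{j≠i} (x_i − x_j)/(x_i + x_j), with the sign of the expansion.  The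
-- variable 0 appended in the odd case never gets matched with a column of B,
-- since (0 | a)^k = 0 for k ≥ 1.  Schur's evaluation itself is the partial
-- fraction expansion of t ↦ ∏_i (t − x_i)/(t + x_i).

module Submission where

open import Defs
open import Level using (Level)
open import Data.Nat.Base as ℕ using (ℕ; zero; suc; _≤_; _∸_; _!)
import Data.Nat.Properties as ℕₚ
open import Data.Nat.ListAction using (sum)
open import Data.Integer.Base as ℤ using (ℤ; -[1+_])
import Data.Integer.Properties as ℤₚ
open import Data.Fin.Base using (Fin; zero; suc; toℕ; inject≤; inject₁; fromℕ; splitAt; opposite)
import Data.Fin.Properties as Finₚ
open import Data.Bool.Base using (Bool; true; false; if_then_else_; not; _∨_; _∧_)
open import Data.Bool.Properties as Boolₚ using (T?)
open import Data.Maybe.Base as Maybe using ()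
open import Data.Product.Base using (_×_; _,_; proj₁; proj₂; uncurry)
open import Data.Sum.Base using (_⊎_; inj₁; inj₂; [_,_]′)
open import Data.Sum.Properties using ([,]-map)
open import Data.List.Base using (List; []; _∷_; map; _++_; _∷ʳ_; length; reverse; tabulate; allFin;
  concatMap; filterᵇ; cartesianProduct)
import Data.List.Properties as Listₚ
open import Data.List.Membership.Propositional using (_∈_)
open import Data.List.Relation.Unary.Any using (here)
open import Data.List.Relation.Unary.All as All using (All; []; _∷_)
import Data.List.Relation.Unary.All.Properties as Allₚ
open import Data.List.Relation.Unary.AllPairs using (AllPairs; []; _∷_)
import Data.List.Relation.Unary.AllPairs.Properties as AllPairsₚ
open import Data.List.Relation.Unary.Unique.Propositional using (Unique)
open import Data.List.Relation.Unary.Unique.Propositional.Properties using (allFin⁺)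
open import Data.List.Relation.Binary.Permutation.Propositional using (_↭_; prep; swap; ↭-refl; ↭-sym; ↭-trans)
open import Data.List.Relation.Binary.Permutation.Propositional.Properties
  using (↭-length; filter-↭; All-resp-↭; ∈-resp-↭)
open import Function.Base using (_∘_; id)
open import Function.Bundles using (mk⇔; module Equivalence)
open import Relation.Nullary.Negation.Core using (¬_; contradiction)
open import Relation.Nullary.Decidable using (yes; no; dec-true; dec-false; dec⇒maybe)
open import Relation.Binary.Definitions using (Symmetric)
open import Relation.Binary.PropositionalEquality as ≡ using (_≡_; _≢_)
open import Algebra.Bundles using (CommutativeRing)
import Algebra.Properties.AbelianGroup
import Algebra.Properties.Ring
import Algebra.Properties.Semiring.Mult.TCOptimised
import Algebra.Solver.Ring as RingSolver
import Algebra.Solver.Ring.AlmostCommutativeRing as ACR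

-- Both sides shrink by deleting one variable at a time, so both are rewritten as recursions on
-- lists of variables, where a deletion needs no reindexing of `Fin n`. Each is compared with
-- `schurSum`: the Pfaffian is `disc` times it, the sum over permutations is the factorial of
-- `n ∸ l` times it. The two sides meet because `row⁻ y r`, the factor of `y` in the summand of the
-- P-function, is also a partial fraction coefficient: the residue of ∏ (t - x_i)/(t + x_i) at t =
-- -y is -2y times it. Hence one lemma, `altSum-disc`, serves every expansion, those inside Schur's
-- evaluation as well as those along columns of B. Schur's evaluation always meets an odd number of
-- poles: the function of t then has the value -1 at t = 0 and 1 at infinity, so the coefficients
-- `row⁻ y r` sum to 1. The reversal of the columns of B puts λ_1 last, so that peeling columns from
-- the right follows the recursion with no extra sign.

private variable
  α β : Level
  A : Set α
  B : Set β
  m n : ℕ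

-- Ring solver with integer coefficients.

module IntegerSolver {c ℓ} (R : CommutativeRing c ℓ) where
  open CommutativeRing R
  open Algebra.Properties.Ring ring
  open Algebra.Properties.AbelianGroup +-abelianGroup
    using (⁻¹-∙-comm; ⁻¹-involutive; ε⁻¹≈ε)
  open Algebra.Properties.Semiring.Mult.TCOptimised semiring renaming (_×_ to _·_)
  open import Relation.Binary.Reasoning.Setoid setoid

  -- The optimised multiple reduces `1 · 1#` to `1#` and `2 · 1#` to `1# + 1#`, so the integer
  -- constants of a solver equation match the goal definitionally.
  ⟦_⟧ℤ : ℤ → Carrier
  ⟦ ℤ.+ n    ⟧ℤ = n · 1#
  ⟦ -[1+ n ] ⟧ℤ = - (suc n · 1#)

  -‿homo : ∀ i → ⟦ ℤ.- i ⟧ℤ ≈ - ⟦ i ⟧ℤ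
  -‿homo ℤ.+0       = sym ε⁻¹≈ε
  -‿homo ℤ.+[1+ n ] = refl
  -‿homo -[1+ n ]   = sym (⁻¹-involutive _)

  shift : ∀ x y → x - y ≈ (1# + x) - (1# + y)
  shift x y = sym (begin
    (1# + x) - (1# + y)      ≈⟨ +-congˡ (⁻¹-∙-comm 1# y) ⟨
    (1# + x) + (- 1# - y)    ≈⟨ +-congʳ (+-comm 1# x) ⟩
    (x + 1#) + (- 1# - y)    ≈⟨ +-assoc x 1# _ ⟩
    x + (1# + (- 1# - y))    ≈⟨ +-congˡ (+-assoc 1# _ _) ⟨
    x + ((1# - 1#) - y)      ≈⟨ +-congˡ (+-congʳ (-‿inverseʳ 1#)) ⟩
    x + (0# - y)             ≈⟨ +-congˡ (+-identityˡ _) ⟩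
    x - y                    ∎)

  ⊖-homo : ∀ m n → ⟦ m ℤ.⊖ n ⟧ℤ ≈ m · 1# - n · 1#
  ⊖-homo m       zero    = sym (trans (+-congˡ ε⁻¹≈ε) (+-identityʳ _))
  ⊖-homo zero    (suc n) = sym (+-identityˡ _)
  ⊖-homo (suc m) (suc n) = begin
    ⟦ suc m ℤ.⊖ suc n ⟧ℤ            ≡⟨ ≡.cong ⟦_⟧ℤ (ℤₚ.[1+m]⊖[1+n]≡m⊖n m n) ⟩
    ⟦ m ℤ.⊖ n ⟧ℤ                    ≈⟨ ⊖-homo m n ⟩
    m · 1# - n · 1#                 ≈⟨ shift _ _ ⟩
    (1# + m · 1#) - (1# + n · 1#)   ≈⟨ +-cong (1+× m 1#) (-‿cong (1+× n 1#)) ⟨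
    suc m · 1# - suc n · 1#         ∎

  +-homo : ∀ i j → ⟦ i ℤ.+ j ⟧ℤ ≈ ⟦ i ⟧ℤ + ⟦ j ⟧ℤ
  +-homo (ℤ.+ m)  (ℤ.+ n)  = ×-homo-+ 1# m n
  +-homo (ℤ.+ m)  -[1+ n ] = ⊖-homo m (suc n)
  +-homo -[1+ m ] (ℤ.+ n)  = trans (⊖-homo n (suc m)) (+-comm _ _)
  +-homo -[1+ m ] -[1+ n ] = begin
    - (suc (suc (m ℕ.+ n)) · 1#)        ≡⟨ ≡.cong (λ k → - (suc k · 1#)) (ℕₚ.+-suc m n) ⟨
    - ((suc m ℕ.+ suc n) · 1#)          ≈⟨ -‿cong (×-homo-+ 1# (suc m) (suc n)) ⟩
    - (suc m · 1# + suc n · 1#)         ≈⟨ ⁻¹-∙-comm _ _ ⟨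
    - (suc m · 1#) - (suc n · 1#)       ∎

  *-homo-+ : ∀ m j → ⟦ (ℤ.+ m) ℤ.* j ⟧ℤ ≈ (m · 1#) * ⟦ j ⟧ℤ
  *-homo-+ m (ℤ.+ n) = begin
    ⟦ (ℤ.+ m) ℤ.* (ℤ.+ n) ⟧ℤ   ≡⟨ ≡.cong ⟦_⟧ℤ (ℤₚ.pos-* m n) ⟨
    (m ℕ.* n) · 1#             ≈⟨ ×1-homo-* m n ⟩
    (m · 1#) * (n · 1#)        ∎
  *-homo-+ m -[1+ n ] = begin
    ⟦ (ℤ.+ m) ℤ.* -[1+ n ] ⟧ℤ          ≡⟨ ≡.cong ⟦_⟧ℤ (ℤₚ.neg-distribʳ-* (ℤ.+ m) ℤ.+[1+ n ]) ⟨
    ⟦ ℤ.- (ℤ.+ m ℤ.* ℤ.+ suc n) ⟧ℤ     ≈⟨ -‿homo (ℤ.+ m ℤ.* ℤ.+ suc n) ⟩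
    - ⟦ ℤ.+ m ℤ.* ℤ.+ suc n ⟧ℤ         ≈⟨ -‿cong (*-homo-+ m (ℤ.+ suc n)) ⟩
    - ((m · 1#) * (suc n · 1#))        ≈⟨ -‿distribʳ-* _ _ ⟩
    (m · 1#) * - (suc n · 1#)          ∎

  *-homo : ∀ i j → ⟦ i ℤ.* j ⟧ℤ ≈ ⟦ i ⟧ℤ * ⟦ j ⟧ℤ
  *-homo (ℤ.+ m)  j = *-homo-+ m j
  *-homo -[1+ m ] j = begin
    ⟦ -[1+ m ] ℤ.* j ⟧ℤ               ≡⟨ ≡.cong ⟦_⟧ℤ (ℤₚ.neg-distribˡ-* ℤ.+[1+ m ] j) ⟨
    ⟦ ℤ.- (ℤ.+ suc m ℤ.* j) ⟧ℤ        ≈⟨ -‿homo (ℤ.+ suc m ℤ.* j) ⟩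
    - ⟦ ℤ.+ suc m ℤ.* j ⟧ℤ            ≈⟨ -‿cong (*-homo-+ (suc m) j) ⟩
    - ((suc m · 1#) * ⟦ j ⟧ℤ)         ≈⟨ -‿distribˡ-* _ _ ⟩
    - (suc m · 1#) * ⟦ j ⟧ℤ           ∎

  almostCommutativeRing : ACR.AlmostCommutativeRing c ℓ
  almostCommutativeRing = ACR.fromCommutativeRing R

  -- Equality in the field is not assumed decidable, so the solver normalises over ℤ, where it is;
  -- this map interprets the coefficients.
  ℤ-morphism : ℤ.+-*-rawRing ACR.-Raw-AlmostCommutative⟶ almostCommutativeRing
  ℤ-morphism = record
    { ⟦_⟧ = ⟦_⟧ℤ ; +-homo = +-homo ; *-homo = *-homo ; -‿homo = -‿homo
    ; 0-homo = refl ; 1-homo = refl }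

  open RingSolver ℤ.+-*-rawRing almostCommutativeRing ℤ-morphism
    (λ i j → Maybe.map (λ i≡j → reflexive (≡.cong ⟦_⟧ℤ i≡j)) (dec⇒maybe (i ℤₚ.≟ j)))
    public
    using (solve; _:=_; _:+_; _:*_; _:-_; :-_; con)

-- Lists with one letter deleted.

double : ℕ → ℕ
double zero    = zero
double (suc n) = suc (suc (double n))

-- `Pick y r xs`: deleting one occurrence of y from xs leaves r.
data Pick {a} {A : Set a} (y : A) : List A → List A → Set a where
  here  : ∀ {xs} → Pick y xs (y ∷ xs)
  there : ∀ {x r xs} → Pick y r xs → Pick y (x ∷ r) (x ∷ xs)

Pick⇒↭ : ∀ {y : A} {r xs} → Pick y r xs → y ∷ r ↭ xs
Pick⇒↭ here              = ↭-refl
Pick⇒↭ (there {x = x} i) = ↭-trans (swap _ x ↭-refl) (prep x (Pick⇒↭ i))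

Pick-length-suc : ∀ {y : A} {r xs} → Pick y r xs → length xs ≡ suc (length r)
Pick-length-suc here      = ≡.refl
Pick-length-suc (there i) = ≡.cong suc (Pick-length-suc i)

Pick-length : ∀ {y : A} {r xs k} → Pick y r xs → length xs ≡ suc k → length r ≡ k
Pick-length i e = ℕₚ.suc-injective (≡.trans (≡.sym (Pick-length-suc i)) e)

Pick-All : ∀ {q} {P : A → Set q} {y r xs} → Pick y r xs → All P xs → P y × All P r
Pick-All here      (p ∷ ps) = p , ps
Pick-All (there i) (p ∷ ps) with q , qs ← Pick-All i ps = q , p ∷ qs

-- For a letter `x` in front of the deleted `y` only `R x y` is recorded, whence the symmetry.
Pick-AllPairs : ∀ {q} {R : A → A → Set q} → Symmetric R →
                ∀ {y r xs} → Pick y r xs → AllPairs R xs → All (R y) r × AllPairs R r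
Pick-AllPairs s here      (p ∷ ps) = p , ps
Pick-AllPairs s (there i) (p ∷ ps) with qs , rs ← Pick-AllPairs s i ps | pxy , pr ← Pick-All i p
  = s pxy ∷ qs , pr ∷ rs

-- Sums over deletions, and the Pfaffian of a list.

module Sums {c ℓ} (F : CharZeroField c ℓ) where
  open CharZeroField F
  open FieldDefs F using (sumL; prodL)
  open IntegerSolver commutativeRing
  open import Relation.Binary.Reasoning.Setoid setoid

  sign : ℕ → Carrier
  sign k = if isEven k then 1# else - 1#

  sign-suc : ∀ k → sign (suc k) ≈ - sign k
  sign-suc zero          = refl
  sign-suc (suc zero)    = solve 0 (con ℤ.1ℤ := :- (:- con ℤ.1ℤ)) refl
  sign-suc (suc (suc k)) = sign-suc k

  sign-double : ∀ k → sign (double k) ≡ 1#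
  sign-double zero    = ≡.refl
  sign-double (suc k) = sign-double k

  -- A skipped `x` is put back in front of `r` by the continuation, so `r` keeps the order of the
  -- list; the signs of a Pfaffian depend on that order.
  pickSum altSum : (A → List A → Carrier) → List A → Carrier
  pickSum G []       = 0#
  pickSum G (x ∷ xs) = G x xs + pickSum (λ y r → G y (x ∷ r)) xs
  altSum G []       = 0#
  altSum G (x ∷ xs) = G x xs - altSum (λ y r → G y (x ∷ r)) xs

  pickSum-cong : ∀ {G H : A → List A → Carrier} xs →
                 (∀ {y r} → Pick y r xs → G y r ≈ H y r) → pickSum G xs ≈ pickSum H xs
  pickSum-cong []       e = refl
  pickSum-cong (x ∷ xs) e = +-cong (e here) (pickSum-cong xs (e ∘ there))

  altSum-cong : ∀ {G H : A → List A → Carrier} xs →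
                (∀ {y r} → Pick y r xs → G y r ≈ H y r) → altSum G xs ≈ altSum H xs
  altSum-cong []       e = refl
  altSum-cong (x ∷ xs) e = +-cong (e here) (-‿cong (altSum-cong xs (e ∘ there)))

  pickSum-0 : ∀ (xs : List A) → pickSum (λ _ _ → 0#) xs ≈ 0#
  pickSum-0 []       = refl
  pickSum-0 (x ∷ xs) = trans (+-identityˡ _) (pickSum-0 xs)

  pickSum-* : ∀ k (G : A → List A → Carrier) xs → pickSum (λ y r → k * G y r) xs ≈ k * pickSum G xs
  pickSum-* k G []       = sym (zeroʳ k)
  pickSum-* k G (x ∷ xs) = trans (+-congˡ (pickSum-* k _ xs)) (sym (distribˡ k _ _))

  pickSum-+ : ∀ (G H : A → List A → Carrier) xs →
              pickSum (λ y r → G y r + H y r) xs ≈ pickSum G xs + pickSum H xs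
  pickSum-+ G H []       = sym (+-identityˡ _)
  pickSum-+ G H (x ∷ xs) = trans (+-congˡ (pickSum-+ _ _ xs))
    (solve 4 (λ a b c d → (a :+ b) :+ (c :+ d) := (a :+ c) :+ (b :+ d)) refl _ _ _ _)

  pickSum-const : ∀ (f : A → Carrier) xs → pickSum (λ y _ → f y) xs ≈ sumL (map f xs)
  pickSum-const f []       = refl
  pickSum-const f (x ∷ xs) = +-congˡ (pickSum-const f xs)

  altSum-0 : ∀ (xs : List A) → altSum (λ _ _ → 0#) xs ≈ 0#
  altSum-0 []       = refl
  altSum-0 (x ∷ xs) = trans (+-congˡ (-‿cong (altSum-0 xs))) (-‿inverseʳ 0#)

  altSum-* : ∀ k (G : A → List A → Carrier) xs → altSum (λ y r → k * G y r) xs ≈ k * altSum G xs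
  altSum-* k G []       = sym (zeroʳ k)
  altSum-* k G (x ∷ xs) = trans (+-congˡ (-‿cong (altSum-* k _ xs)))
    (solve 3 (λ a b c → a :* b :- a :* c := a :* (b :- c)) refl k _ _)

  altSum-- : ∀ (G H : A → List A → Carrier) xs →
             altSum (λ y r → G y r - H y r) xs ≈ altSum G xs - altSum H xs
  altSum-- G H []       = sym (-‿inverseʳ 0#)
  altSum-- G H (x ∷ xs) = trans (+-congˡ (-‿cong (altSum-- _ _ xs)))
    (solve 4 (λ a b c d → (a :- b) :- (c :- d) := (a :- c) :- (b :- d)) refl _ _ _ _)

  pickSum-map : ∀ (f : A → B) (G : B → List B → Carrier) xs →
                pickSum G (map f xs) ≡ pickSum (λ y r → G (f y) (map f r)) xs
  pickSum-map f G []       = ≡.refl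
  pickSum-map f G (x ∷ xs) = ≡.cong (G (f x) (map f xs) +_) (pickSum-map f _ xs)

  altSum-map : ∀ (f : A → B) (G : B → List B → Carrier) xs →
               altSum G (map f xs) ≡ altSum (λ y r → G (f y) (map f r)) xs
  altSum-map f G []       = ≡.refl
  altSum-map f G (x ∷ xs) = ≡.cong (λ s → G (f x) (map f xs) - s) (altSum-map f _ xs)

  altSum-∷ʳ : ∀ (G : A → List A → Carrier) xs t →
              altSum G (xs ∷ʳ t) ≈ altSum (λ y r → G y (r ∷ʳ t)) xs + sign (length xs) * G t xs
  altSum-∷ʳ G []       t = solve 1 (λ a → a :- con ℤ.0ℤ := con ℤ.0ℤ :+ con ℤ.1ℤ :* a) refl _
  altSum-∷ʳ G (x ∷ xs) t = begin
    G x (xs ∷ʳ t) - altSum (λ y r → G y (x ∷ r)) (xs ∷ʳ t)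
      ≈⟨ +-congˡ (-‿cong (altSum-∷ʳ _ xs t)) ⟩
    G x (xs ∷ʳ t) - (altSum (λ y r → G y (x ∷ r ∷ʳ t)) xs + sign (length xs) * G t (x ∷ xs))
      ≈⟨ solve 4 (λ a b c d → a :- (b :+ c :* d) := (a :- b) :+ (:- c) :* d) refl _ _ _ _ ⟩
    altSum (λ y r → G y (r ∷ʳ t)) (x ∷ xs) + - sign (length xs) * G t (x ∷ xs)
      ≈⟨ +-congˡ (*-congʳ (sign-suc (length xs))) ⟨
    altSum (λ y r → G y (r ∷ʳ t)) (x ∷ xs) + sign (length (x ∷ xs)) * G t (x ∷ xs) ∎

  altSum-++-0 : ∀ (G : A → List A → Carrier) xs {ts} → All (λ t → ∀ r → G t r ≈ 0#) ts →
                altSum G (xs ++ ts) ≈ altSum (λ y r → G y (r ++ ts)) xs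
  altSum-++-0 G [] {ts} z = trans (altSum-cong ts (λ i → let e , _ = Pick-All i z in e _)) (altSum-0 ts)
  altSum-++-0 G (x ∷ xs) z = +-congˡ (-‿cong (altSum-++-0 _ xs (All.map (λ e r → e (x ∷ r)) z)))

  -- Two letters can be deleted in either order. When the earlier one goes first, the later one
  -- moves up by one place, so the two orders carry opposite signs.
  altSum-swap : ∀ (H : A → A → List A → Carrier) xs →
                altSum (λ y r → altSum (H y) r) xs ≈ - altSum (λ z r → altSum (λ y → H y z) r) xs
  altSum-swap H []       = solve 0 (con ℤ.0ℤ := :- con ℤ.0ℤ) refl
  altSum-swap H (x ∷ xs) = begin
    altSum (H x) xs - altSum (λ y r → H y x r - altSum (λ z r′ → H y z (x ∷ r′)) r) xs
      ≈⟨ +-congˡ (-‿cong (trans (altSum-- _ _ xs) (+-congˡ (-‿cong (altSum-swap _ xs))))) ⟩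
    a - (b - - d)
      ≈⟨ solve 3 (λ a b d → a :- (b :- (:- d)) := :- (b :- (a :- d))) refl a b d ⟩
    - (b - (a - d))
      ≈⟨ -‿cong (+-congˡ (-‿cong (altSum-- _ _ xs))) ⟨
    - (altSum (λ y → H y x) xs - altSum (λ z r → H x z r - altSum (λ y r′ → H y z (x ∷ r′)) r) xs) ∎
    where
    a = altSum (H x) xs
    b = altSum (λ y → H y x) xs
    d = altSum (λ z r → altSum (λ y r′ → H y z (x ∷ r′)) r) xs

  -- Meaningful for length xs = double k only: the Pfaffian of M restricted to
  -- the rows and columns in xs, expanded along its first row.
  pf : ℕ → (A → A → Carrier) → List A → Carrier
  pf zero    M xs       = 1#
  pf (suc k) M []       = 0#
  pf (suc k) M (x ∷ xs) = altSum (λ y r → M x y * pf k M r) xs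

  pf-map : ∀ k {M : A → A → Carrier} {M′ : B → B → Carrier} (f : A → B) →
           (∀ x y → M x y ≈ M′ (f x) (f y)) → ∀ xs → pf k M xs ≈ pf k M′ (map f xs)
  pf-map zero    f e xs       = refl
  pf-map (suc k) f e []       = refl
  pf-map (suc k) {M} {M′} f e (x ∷ xs) = begin
    altSum (λ y r → M x y * pf k M r) xs                      ≈⟨ altSum-cong xs (λ _ → *-cong (e x _) (pf-map k f e _)) ⟩
    altSum (λ y r → M′ (f x) (f y) * pf k M′ (map f r)) xs    ≡⟨ altSum-map f _ xs ⟨
    altSum (λ y r → M′ (f x) y * pf k M′ r) (map f xs)        ∎

  -- The definition of `pf` only expands along the first row. In each of its terms but the one of
  -- `t`, the smaller Pfaffian is expanded along `t` by induction; `altSum-swap` exchanges the two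
  -- deletions, and the inner sum becomes the first-row expansion of the Pfaffian without `z` and
  -- `t`. The term that pairs the first letter with `t` is the leading term of the new expansion.
  pf-∷ʳ : ∀ k (M : A → A → Carrier) ys t → length ys ≡ suc (double k) →
          pf (suc k) M (ys ∷ʳ t) ≈ altSum (λ y r → M y t * pf k M r) ys
  pf-∷ʳ zero    M (x ∷ [])      t e = refl
  pf-∷ʳ (suc k) M (x ∷ ys) t e = begin
    altSum (λ y r → M x y * pf (suc k) M r) (ys ∷ʳ t)
      ≈⟨ altSum-∷ʳ _ ys t ⟩
    altSum (λ y r → M x y * pf (suc k) M (r ∷ʳ t)) ys + sign (length ys) * top
      ≈⟨ +-cong (altSum-cong ys (λ {y} {r} i →
           trans (*-congˡ (pf-∷ʳ k M r t (Pick-length i e′))) (sym (altSum-* _ _ r))))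
           -- An even number of letters stands between `x` and `t`, so their pair carries the sign
           -- +.
           (*-congʳ (reflexive (≡.trans (≡.cong sign e′) (sign-double (suc k))))) ⟩
    altSum (λ y r → altSum (λ z r′ → M x y * (M z t * pf k M r′)) r) ys + 1# * top
      ≈⟨ +-congʳ (altSum-swap _ ys) ⟩
    - altSum (λ z r → altSum (λ y r′ → M x y * (M z t * pf k M r′)) r) ys + 1# * top
      ≈⟨ +-congʳ (-‿cong (altSum-cong ys (λ {z} {r} _ → trans
           (altSum-cong r (λ _ → solve 3 (λ a b c → a :* (b :* c) := b :* (a :* c)) refl _ _ _))
           (altSum-* _ _ r)))) ⟩
    - altSum (λ z r → M z t * pf (suc k) M (x ∷ r)) ys + 1# * top
      ≈⟨ solve 2 (λ a b → :- a :+ con ℤ.1ℤ :* b := b :- a) refl _ top ⟩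
    top - altSum (λ z r → M z t * pf (suc k) M (x ∷ r)) ys ∎
    where
    top : Carrier
    top = M x t * pf (suc k) M ys
    e′ : length ys ≡ double (suc k)
    e′ = ℕₚ.suc-injective e

-- Partial fractions and Schur's Pfaffian.

module Schur {c ℓ} (F : CharZeroField c ℓ) where
  open CharZeroField F
  open FieldDefs F
  open IntegerSolver commutativeRing
  open Sums F
  open import Relation.Binary.Reasoning.Setoid setoid

  _≉0 : Carrier → Set ℓ
  x ≉0 = ¬ (x ≈ 0#)

  1≉0 : 1# ≉0
  1≉0 e = charZero 0 (trans (+-identityʳ 1#) e)

  2≉0 : (1# + 1#) ≉0
  2≉0 e = charZero 1 (trans (+-congˡ (+-identityʳ 1#)) e)

  *-cancelˡ : ∀ {x y z} → x ≉0 → x * y ≈ x * z → y ≈ z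
  *-cancelˡ {x} {y} {z} x≉0 e = begin
    y               ≈⟨ unit y ⟩
    x ⁻¹ * (x * y)  ≈⟨ *-congˡ e ⟩
    x ⁻¹ * (x * z)  ≈⟨ unit z ⟨
    z               ∎
    where
    unit : ∀ w → w ≈ x ⁻¹ * (x * w)
    unit w = begin
      w               ≈⟨ *-identityˡ w ⟨
      1# * w          ≈⟨ *-congʳ (⁻¹-inverse x x≉0) ⟨
      x * x ⁻¹ * w    ≈⟨ solve 3 (λ a b c → a :* b :* c := b :* (a :* c)) refl x (x ⁻¹) w ⟩
      x ⁻¹ * (x * w)  ∎

  *-≉0 : ∀ {x y} → x ≉0 → y ≉0 → (x * y) ≉0
  *-≉0 x≉0 y≉0 e = y≉0 (*-cancelˡ x≉0 (trans e (sym (zeroʳ _))))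

  ⁻¹-≉0 : ∀ {x} → x ≉0 → (x ⁻¹) ≉0
  ⁻¹-≉0 x≉0 e = 1≉0 (trans (sym (⁻¹-inverse _ x≉0)) (trans (*-congˡ e) (zeroʳ _)))

  /-cong : ∀ {x y z w} → x ≈ y → z ≈ w → x / z ≈ y / w
  /-cong e f = *-cong e (⁻¹-cong f)

  *≈⇒≈/ : ∀ {x y z} → z ≉0 → x * z ≈ y → x ≈ y / z
  *≈⇒≈/ {x} {y} {z} z≉0 e = begin
    x             ≈⟨ *-identityʳ x ⟨
    x * 1#        ≈⟨ *-congˡ (⁻¹-inverse z z≉0) ⟨
    x * (z / z)   ≈⟨ *-assoc x z _ ⟨
    (x * z) / z   ≈⟨ *-congʳ e ⟩
    y / z         ∎

  quot quot⁻ : Carrier → Carrier → Carrier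
  quot  u v = (u - v) / (u + v)
  quot⁻ u v = (u + v) / (u - v)

  row row⁻ : Carrier → List Carrier → Carrier
  row  t xs = prodL (map (quot t) xs)
  row⁻ t xs = prodL (map (quot⁻ t) xs)

  disc : List Carrier → Carrier
  disc []       = 1#
  disc (x ∷ xs) = row x xs * disc xs

  Generic : Carrier → Carrier → Set ℓ
  Generic u v = (u - v) ≉0 × (u + v) ≉0

  Generic-sym : Symmetric Generic
  Generic-sym {u} {v} (d , s) =
    (λ e → d (trans (solve 2 (λ u v → u :- v := :- (v :- u)) refl u v)
               (trans (-‿cong e) (solve 0 (:- con ℤ.0ℤ := con ℤ.0ℤ) refl)))) ,
    (λ e → s (trans (+-comm u v) e))

  prodL-map-Pick : ∀ (f : A → Carrier) {y r xs} → Pick y r xs →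
                   prodL (map f xs) ≈ f y * prodL (map f r)
  prodL-map-Pick f here      = refl
  prodL-map-Pick f (there i) = trans (*-congˡ (prodL-map-Pick f i))
    (solve 3 (λ a b c → a :* (b :* c) := b :* (a :* c)) refl _ _ _)

  prodL-map-cong : ∀ {f g : A → Carrier} {xs} → All (λ x → f x ≈ g x) xs →
                   prodL (map f xs) ≈ prodL (map g xs)
  prodL-map-cong []       = refl
  prodL-map-cong (e ∷ es) = *-cong e (prodL-map-cong es)

  quot-≉0 : ∀ {u v} → Generic u v → quot u v ≉0
  quot-≉0 (d , s) = *-≉0 d (⁻¹-≉0 s)

  disc-≉0 : ∀ {xs} → AllPairs Generic xs → disc xs ≉0
  disc-≉0 []       = 1≉0
  disc-≉0 (g ∷ gs) = *-≉0 (row-≉0 g) (disc-≉0 gs)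
    where
    row-≉0 : ∀ {x xs} → All (Generic x) xs → row x xs ≉0
    row-≉0 []       = 1≉0
    row-≉0 (g ∷ gs) = *-≉0 (quot-≉0 g) (row-≉0 gs)

  quot-quot⁻ : ∀ {u v} → Generic u v → quot u v * quot⁻ u v ≈ 1#
  quot-quot⁻ {u} {v} (d , s) = begin
    (u - v) / (u + v) * ((u + v) / (u - v))
      ≈⟨ solve 4 (λ a b c d → a :* b :* (c :* d) := (a :* d) :* (c :* b)) refl _ _ _ _ ⟩
    (u - v) / (u - v) * ((u + v) / (u + v))
      ≈⟨ *-cong (⁻¹-inverse _ d) (⁻¹-inverse _ s) ⟩
    1# * 1#  ≈⟨ *-identityʳ 1# ⟩
    1#       ∎

  row-row⁻ : ∀ {x xs} → All (Generic x) xs → row x xs * row⁻ x xs ≈ 1#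
  row-row⁻ []       = *-identityʳ 1#
  row-row⁻ {x} {y ∷ xs} (g ∷ gs) = begin
    quot x y * row x xs * (quot⁻ x y * row⁻ x xs)
      ≈⟨ solve 4 (λ a b c d → a :* b :* (c :* d) := (a :* c) :* (b :* d)) refl _ _ _ _ ⟩
    quot x y * quot⁻ x y * (row x xs * row⁻ x xs)  ≈⟨ *-cong (quot-quot⁻ g) (row-row⁻ gs) ⟩
    1# * 1#  ≈⟨ *-identityʳ 1# ⟩
    1#       ∎

  -x+y≉0 : ∀ {x y} → Generic x y → (- x + y) ≉0
  -x+y≉0 {x} {y} (d , _) e = d (begin
    x - y        ≈⟨ solve 2 (λ x y → x :- y := :- (:- x :+ y)) refl x y ⟩
    - (- x + y)  ≈⟨ -‿cong e ⟩
    - 0#         ≈⟨ solve 0 (:- con ℤ.0ℤ := con ℤ.0ℤ) refl ⟩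
    0#           ∎)

  -- Multiplied over a list, this makes `row⁻ x xs` the value of `row` at `- x`, to which an
  -- expansion valid for all admissible `t` applies.
  quot⁻-neg : ∀ {x y} → Generic x y → quot⁻ x y ≈ quot (- x) y
  quot⁻-neg {x} {y} g@(d , _) = *≈⇒≈/ (-x+y≉0 g) (begin
    (x + y) / (x - y) * (- x + y)
      ≈⟨ solve 3 (λ x y w → (x :+ y) :* w :* (:- x :+ y) := (:- x :- y) :* ((x :- y) :* w)) refl x y _ ⟩
    (- x - y) * ((x - y) / (x - y))  ≈⟨ *-congˡ (⁻¹-inverse _ d) ⟩
    (- x - y) * 1#                   ≈⟨ *-identityʳ _ ⟩
    - x - y                          ∎)

  quot-swap : ∀ {u v} → Generic u v → quot u v ≈ - quot v u
  quot-swap {u} {v} (_ , s) = begin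
    (u - v) / (u + v)        ≈⟨ *-congˡ (⁻¹-cong (+-comm u v)) ⟩
    (u - v) / (v + u)        ≈⟨ solve 3 (λ u v w → (u :- v) :* w := :- ((v :- u) :* w)) refl u v _ ⟩
    - ((v - u) / (v + u))    ∎

  quot-as-1-2v/u+v : ∀ {u v} → (u + v) ≉0 → quot u v ≈ 1# - (v + v) / (u + v)
  quot-as-1-2v/u+v {u} {v} s = begin
    (u - v) * w
      ≈⟨ solve 3 (λ u v w → (u :- v) :* w := (u :+ v) :* w :- (v :+ v) :* w) refl u v w ⟩
    (u + v) * w - (v + v) * w
      ≈⟨ +-congʳ (⁻¹-inverse _ s) ⟩
    1# - (v + v) * w ∎
    where w = (u + v) ⁻¹

  -- Induction on the list for all `t` at once. The factor of `x` brings a new pole, whose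
  -- coefficient `row⁻ x xs` is the value of the old product at `- x`, again given by the induction
  -- hypothesis. At each old pole a product of two simple fractions arises, which `term` splits.
  partial-fractions : ∀ {xs} t → AllPairs Generic xs → All (λ x → (t + x) ≉0) xs →
    row t xs ≈ 1# - pickSum (λ y r → ((y + y) * row⁻ y r) / (t + y)) xs
  partial-fractions t []       []       = solve 0 (con ℤ.1ℤ := con ℤ.1ℤ :- con ℤ.0ℤ) refl
  partial-fractions {x ∷ xs} t (g ∷ gs) (s ∷ ss) = begin
    quot t x * row t xs
      ≈⟨ *-cong (quot-as-1-2v/u+v s) (partial-fractions t gs ss) ⟩
    (1# - (x + x) * u) * (1# - S₁)
      -- `T` stands for `S₂` and cancels: it is inserted to make `1# - S₂`, the coefficient of the
      -- new pole, appear.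
      ≈⟨ solve 4 (λ a u S T → (con ℤ.1ℤ :- a :* u) :* (con ℤ.1ℤ :- S) :=
           con ℤ.1ℤ :- ((a :* (con ℤ.1ℤ :- T)) :* u :+ ((con ℤ.1ℤ :- a :* u) :* S :+ (a :* u) :* T)))
         refl (x + x) u S₁ S₂ ⟩
    1# - (((x + x) * (1# - S₂)) * u + ((1# - (x + x) * u) * S₁ + ((x + x) * u) * S₂))
      ≈⟨ +-congˡ (-‿cong (+-cong (*-congʳ (*-congˡ row⁻-x)) S₃-split)) ⟨
    1# - (((x + x) * row⁻ x xs) * u + S₃) ∎
    where
    u = (t + x) ⁻¹
    S₁ = pickSum (λ y r → ((y + y) * row⁻ y r) / (t + y)) xs
    S₂ = pickSum (λ y r → ((y + y) * row⁻ y r) / (- x + y)) xs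
    S₃ = pickSum (λ y r → ((y + y) * row⁻ y (x ∷ r)) / (t + y)) xs
    row⁻-x : row⁻ x xs ≈ 1# - S₂
    row⁻-x = trans (prodL-map-cong (All.map quot⁻-neg g)) (partial-fractions (- x) gs (All.map -x+y≉0 g))
    term : ∀ {y r} → Generic x y → (t + y) ≉0 →
           ((y + y) * row⁻ y (x ∷ r)) / (t + y) ≈
           (1# - (x + x) * u) * (((y + y) * row⁻ y r) / (t + y)) + ((x + x) * u) * (((y + y) * row⁻ y r) / (- x + y))
    term {y} {r} gxy t+y = begin
      ((y + y) * ((y + x) * v * ρ)) * w
        ≈⟨ solve 5 (λ x y v w ρ → ((y :+ y) :* ((y :+ x) :* v :* ρ)) :* w :=
             ((y :+ y) :* ρ) :* ((y :+ x) :* v :* w)) refl x y v w ρ ⟩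
      ((y + y) * ρ) * ((y + x) * v * w)
        ≈⟨ *-congˡ core ⟩
      ((y + y) * ρ) * ((1# - (x + x) * u) * w + (x + x) * u * v)
        ≈⟨ solve 5 (λ a b c w v → a :* (b :* w :+ c :* v) := b :* (a :* w) :+ c :* (a :* v)) refl _ _ _ w v ⟩
      (1# - (x + x) * u) * (((y + y) * ρ) * w) + ((x + x) * u) * (((y + y) * ρ) * v)
        ≈⟨ +-congˡ (*-congˡ (*-congˡ (⁻¹-cong (+-comm y (- x))))) ⟩
      (1# - (x + x) * u) * (((y + y) * ρ) * w) + ((x + x) * u) * (((y + y) * ρ) * (- x + y) ⁻¹) ∎
      where
      v = (y - x) ⁻¹
      w = (t + y) ⁻¹
      ρ = row⁻ y r
      -- Over the common denominator this reads (y + x)(t + x) = (t - x)(y - x) + 2x(t + y).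
      core : (y + x) * v * w ≈ (1# - (x + x) * u) * w + (x + x) * u * v
      core = begin
        (y + x) * v * w
          ≈⟨ *-identityʳ _ ⟨
        (y + x) * v * w * 1#
          ≈⟨ *-congˡ (⁻¹-inverse _ s) ⟨
        (y + x) * v * w * ((t + x) * u)
          ≈⟨ solve 6 (λ t x y u v w →
               (y :+ x) :* v :* w :* ((t :+ x) :* u) :=
               ((t :+ x) :* u :- (x :+ x) :* u) :* w :* ((y :- x) :* v) :+ (x :+ x) :* u :* v :* ((t :+ y) :* w))
             refl t x y u v w ⟩
        ((t + x) * u - (x + x) * u) * w * ((y - x) * v) + (x + x) * u * v * ((t + y) * w)
          ≈⟨ +-cong (*-cong (*-congʳ (+-congʳ (⁻¹-inverse _ s))) (⁻¹-inverse _ (proj₁ (Generic-sym gxy))))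
                    (*-congˡ (⁻¹-inverse _ t+y)) ⟩
        (1# - (x + x) * u) * w * 1# + (x + x) * u * v * 1#
          ≈⟨ +-cong (*-identityʳ _) (*-identityʳ _) ⟩
        (1# - (x + x) * u) * w + (x + x) * u * v ∎
    S₃-split : S₃ ≈ (1# - (x + x) * u) * S₁ + ((x + x) * u) * S₂
    S₃-split = begin
      S₃ ≈⟨ pickSum-cong xs (λ {y} {r} i → term {y} {r} (proj₁ (Pick-All i g)) (proj₁ (Pick-All i ss))) ⟩
      pickSum (λ y r → (1# - (x + x) * u) * (((y + y) * row⁻ y r) / (t + y)) +
                       ((x + x) * u) * (((y + y) * row⁻ y r) / (- x + y))) xs
         ≈⟨ pickSum-+ _ _ xs ⟩
      _  ≈⟨ +-cong (pickSum-* _ _ xs) (pickSum-* _ _ xs) ⟩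
      (1# - (x + x) * u) * S₁ + ((x + x) * u) * S₂ ∎

  row-0 : ∀ {xs} → All _≉0 xs → row 0# xs ≈ sign (length xs)
  row-0 [] = refl
  row-0 {x ∷ xs} (z ∷ zs) = begin
    (0# - x) / (0# + x) * row 0# xs
      ≈⟨ *-cong (/-cong (+-identityˡ _) (+-identityˡ x)) (row-0 zs) ⟩
    - x * x ⁻¹ * sign (length xs)
      ≈⟨ solve 3 (λ a b c → :- a :* b :* c := :- ((a :* b) :* c)) refl _ _ _ ⟩
    - (x * x ⁻¹ * sign (length xs))
      ≈⟨ -‿cong (trans (*-congʳ (⁻¹-inverse x z)) (*-identityˡ _)) ⟩
    - sign (length xs)
      ≈⟨ sign-suc (length xs) ⟨
    sign (suc (length xs)) ∎

  -- Partial fractions at t = 0.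
  pickSum-row⁻ : ∀ {xs} k → AllPairs Generic xs → All _≉0 xs → length xs ≡ suc (double k) →
                 pickSum row⁻ xs ≈ 1#
  pickSum-row⁻ {xs} k gs zs odd = *-cancelˡ 2≉0 (begin
    (1# + 1#) * S
      ≈⟨ pickSum-* _ _ xs ⟨
    pickSum (λ y r → (1# + 1#) * row⁻ y r) xs
      ≈⟨ pickSum-cong xs (λ {y} {r} i → term {y} {r} (proj₁ (Pick-All i zs))) ⟩
    T
      ≈⟨ solve 1 (λ T → T := con ℤ.1ℤ :- (con ℤ.1ℤ :- T)) refl T ⟩
    1# - (1# - T)
      ≈⟨ +-congˡ (-‿cong (partial-fractions 0# gs (All.map (λ z e → z (trans (sym (+-identityˡ _)) e)) zs))) ⟨
    1# - row 0# xs
      ≈⟨ +-congˡ (-‿cong (trans (row-0 zs) (trans (reflexive (≡.cong sign odd)) sign-odd))) ⟩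
    1# - - 1#
      ≈⟨ solve 0 (con ℤ.1ℤ :- (:- con ℤ.1ℤ) := con (ℤ.+ 2) :* con ℤ.1ℤ) refl ⟩
    (1# + 1#) * 1# ∎)
    where
    S = pickSum row⁻ xs
    T = pickSum (λ y r → ((y + y) * row⁻ y r) / (0# + y)) xs
    sign-odd : sign (suc (double k)) ≈ - 1#
    sign-odd = trans (sign-suc (double k)) (-‿cong (reflexive (sign-double k)))
    term : ∀ {y r} → y ≉0 → (1# + 1#) * row⁻ y r ≈ ((y + y) * row⁻ y r) / (0# + y)
    term {y} {r} z = *≈⇒≈/ (λ e → z (trans (sym (+-identityˡ _)) e))
      (solve 2 (λ y ρ → con (ℤ.+ 2) :* ρ :* (con ℤ.0ℤ :+ y) := (y :+ y) :* ρ) refl y (row⁻ y r))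

  -- Writing `quot t y` as 1 - 2y/(t + y) splits the sum into the constant 1 of `pickSum-row⁻` and
  -- the pole terms of the expansion at `t`.
  pickSum-quot-row⁻ : ∀ {xs} k t → AllPairs Generic xs → All _≉0 xs → All (λ x → (t + x) ≉0) xs →
                      length xs ≡ suc (double k) →
                      pickSum (λ y r → quot t y * row⁻ y r) xs ≈ row t xs
  pickSum-quot-row⁻ {xs} k t gs zs ss odd = begin
    pickSum (λ y r → quot t y * row⁻ y r) xs
      ≈⟨ pickSum-cong xs (λ {y} i → trans (*-congʳ (quot-as-1-2v/u+v (proj₁ (Pick-All i ss))))
           (solve 3 (λ a w ρ → (con ℤ.1ℤ :- a :* w) :* ρ := ρ :+ (:- con ℤ.1ℤ) :* ((a :* ρ) :* w)) refl _ _ _)) ⟩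
    pickSum (λ y r → row⁻ y r + - 1# * (((y + y) * row⁻ y r) / (t + y))) xs
      ≈⟨ pickSum-+ _ _ xs ⟩
    _ ≈⟨ +-cong (pickSum-row⁻ k gs zs odd) (pickSum-* _ _ xs) ⟩
    1# + - 1# * pickSum (λ y r → ((y + y) * row⁻ y r) / (t + y)) xs
      ≈⟨ solve 1 (λ T → con ℤ.1ℤ :+ (:- con ℤ.1ℤ) :* T := con ℤ.1ℤ :- T) refl _ ⟩
    1# - pickSum (λ y r → ((y + y) * row⁻ y r) / (t + y)) xs
      ≈⟨ partial-fractions t gs ss ⟨
    row t xs ∎

  -- Collecting the factors of `y` turns `quot x y` into `- quot y x` for every `x` ahead of `y`,
  -- which produces exactly the alternating sign. The factor `f` may depend on the remaining list:
  -- the induction hides `row x r` in it, and the columns of B leave a whole `schurSum` there.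
  altSum-disc : ∀ (f : Carrier → List Carrier → Carrier) {xs} → AllPairs Generic xs →
    altSum (λ y r → f y r * disc r) xs ≈ disc xs * pickSum (λ y r → f y r * row⁻ y r) xs
  altSum-disc f []       = sym (zeroʳ 1#)
  altSum-disc f {x ∷ xs} (g ∷ gs) = begin
    f x xs * disc xs - altSum (λ y r → f y (x ∷ r) * (row x r * disc r)) xs
      ≈⟨ +-cong
           (trans (sym (*-identityˡ _)) (*-congʳ (sym (row-row⁻ g))))
           (-‿cong (trans (altSum-cong xs (λ _ → sym (*-assoc _ _ _)))
                          (altSum-disc (λ y r → f y (x ∷ r) * row x r) gs))) ⟩
    row x xs * row⁻ x xs * (f x xs * disc xs) - disc xs * P
      ≈⟨ solve 5 (λ a b c d P → a :* b :* (c :* d) :- d :* P := d :* (a :* (c :* b) :+ (:- con ℤ.1ℤ) :* P))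
         refl (row x xs) (row⁻ x xs) (f x xs) (disc xs) P ⟩
    disc xs * (row x xs * (f x xs * row⁻ x xs) + - 1# * P)
      ≈⟨ *-congˡ (+-congˡ Q≈-P) ⟨
    disc xs * (row x xs * (f x xs * row⁻ x xs) + row x xs * Q)
      ≈⟨ solve 4 (λ a b c d → d :* (a :* b :+ a :* c) := a :* d :* (b :+ c)) refl _ _ Q (disc xs) ⟩
    row x xs * disc xs * (f x xs * row⁻ x xs + Q) ∎
    where
    P = pickSum (λ y r → f y (x ∷ r) * row x r * row⁻ y r) xs
    Q = pickSum (λ y r → f y (x ∷ r) * (quot⁻ y x * row⁻ y r)) xs
    Q≈-P : row x xs * Q ≈ - 1# * P
    Q≈-P = begin
      row x xs * Q  ≈⟨ pickSum-* _ _ xs ⟨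
      pickSum (λ y r → row x xs * (f y (x ∷ r) * (quot⁻ y x * row⁻ y r))) xs
        ≈⟨ pickSum-cong xs (λ {y} {r} i → let gyx = Generic-sym (proj₁ (Pick-All i g)) in begin
             row x xs * (f y (x ∷ r) * (quot⁻ y x * row⁻ y r))
               ≈⟨ *-congʳ (trans (prodL-map-Pick (quot x) i) (*-congʳ (quot-swap (proj₁ (Pick-All i g))))) ⟩
             - quot y x * row x r * (f y (x ∷ r) * (quot⁻ y x * row⁻ y r))
               ≈⟨ solve 5 (λ a b c d e → :- a :* b :* (c :* (d :* e)) := a :* d :* (:- con ℤ.1ℤ :* (c :* b :* e)))
                    refl (quot y x) (row x r) (f y (x ∷ r)) (quot⁻ y x) (row⁻ y r) ⟩
             quot y x * quot⁻ y x * (- 1# * (f y (x ∷ r) * row x r * row⁻ y r))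
               ≈⟨ trans (*-congʳ (quot-quot⁻ gyx)) (*-identityˡ _) ⟩
             - 1# * (f y (x ∷ r) * row x r * row⁻ y r) ∎) ⟩
      pickSum (λ y r → - 1# * (f y (x ∷ r) * row x r * row⁻ y r)) xs
        ≈⟨ pickSum-* _ _ xs ⟩
      - 1# * P ∎

  -- Expansion along the first row leaves Schur products with `y` deleted; the sum over `y` is then
  -- the partial fraction identity at `t = x`, with an odd number of poles.
  pf-quot-even : ∀ k {xs} → AllPairs Generic xs → All _≉0 xs → length xs ≡ double k →
                 pf k quot xs ≈ disc xs
  pf-quot-even zero    {[]}     gs zs e = refl
  pf-quot-even (suc k) {x ∷ xs} (g ∷ gs) (_ ∷ zs) e = begin
    altSum (λ y r → quot x y * pf k quot r) xs
      ≈⟨ altSum-cong xs (λ i → *-congˡ (pf-quot-even k (proj₂ (Pick-AllPairs Generic-sym i gs))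
           (proj₂ (Pick-All i zs)) (Pick-length i odd))) ⟩
    altSum (λ y r → quot x y * disc r) xs
      ≈⟨ altSum-disc (λ y _ → quot x y) gs ⟩
    disc xs * pickSum (λ y r → quot x y * row⁻ y r) xs
      ≈⟨ *-congˡ (pickSum-quot-row⁻ k x gs zs (All.map proj₂ g) odd) ⟩
    disc xs * row x xs
      ≈⟨ *-comm _ _ ⟩
    row x xs * disc xs ∎
    where
    odd : length xs ≡ suc (double k)
    odd = ℕₚ.suc-injective e

  -- `pf-quot-even` asks for nonzero variables and cannot absorb the appended 0. Along its column,
  -- however, all entries are 1, and the coefficients sum to 1.
  pf-quot-odd : ∀ k {xs} → AllPairs Generic xs → All _≉0 xs → length xs ≡ suc (double k) →
                pf (suc k) quot (xs ∷ʳ 0#) ≈ disc xs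
  pf-quot-odd k {xs} gs zs odd = begin
    pf (suc k) quot (xs ∷ʳ 0#)
      ≈⟨ pf-∷ʳ k quot xs 0# odd ⟩
    altSum (λ y r → quot y 0# * pf k quot r) xs
      ≈⟨ altSum-cong xs (λ i → *-cong (quot-0 (proj₁ (Pick-All i zs)))
           (pf-quot-even k (proj₂ (Pick-AllPairs Generic-sym i gs)) (proj₂ (Pick-All i zs)) (Pick-length i odd))) ⟩
    altSum (λ y r → 1# * disc r) xs
      ≈⟨ altSum-disc (λ _ _ → 1#) gs ⟩
    disc xs * pickSum (λ y r → 1# * row⁻ y r) xs
      ≈⟨ *-congˡ (trans (pickSum-cong xs (λ _ → *-identityˡ _)) (pickSum-row⁻ k gs zs odd)) ⟩
    disc xs * 1#
      ≈⟨ *-identityʳ _ ⟩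
    disc xs ∎
    where
    quot-0 : ∀ {y} → y ≉0 → quot y 0# ≈ 1#
    quot-0 {y} z = trans (/-cong (solve 1 (λ y → y :- con ℤ.0ℤ := y) refl y) (+-identityʳ y)) (⁻¹-inverse y z)

-- Sums over the orderings of a list.

module PermutationSums {c ℓ} (F : CharZeroField c ℓ) where
  open CharZeroField F renaming (refl to ≈-refl; trans to ≈-trans) hiding (zero)
  open FieldDefs F
  open IntegerSolver commutativeRing
  open Sums F
  open import Relation.Binary.Reasoning.Setoid setoid

  -- Meaningful for m = length xs only: the sum of W over the orderings of xs.
  permSum : ℕ → (List A → Carrier) → List A → Carrier
  permSum zero    W xs = W []
  permSum (suc m) W xs = pickSum (λ y r → permSum m (λ w → W (y ∷ w)) r) xs

  permSum-cong : ∀ m {V W : List A → Carrier} xs → length xs ≡ m →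
                 (∀ w → w ↭ xs → V w ≈ W w) → permSum m V xs ≈ permSum m W xs
  permSum-cong zero    [] _ e = e [] ↭-refl
  permSum-cong (suc m) xs l e = pickSum-cong xs λ {y} i →
    permSum-cong m _ (Pick-length i l) (λ w p → e (y ∷ w) (↭-trans (prep y p) (Pick⇒↭ i)))

  permSum-* : ∀ m k (W : List A → Carrier) xs → permSum m (λ w → k * W w) xs ≈ k * permSum m W xs
  permSum-* zero    k W xs = ≈-refl
  permSum-* (suc m) k W xs = ≈-trans (pickSum-cong xs (λ _ → permSum-* m k _ _)) (pickSum-* k _ xs)

  permSum-map : ∀ m (f : A → B) (W : List B → Carrier) xs → permSum m W (map f xs) ≈ permSum m (W ∘ map f) xs
  permSum-map zero    f W xs = ≈-refl
  permSum-map (suc m) f W xs = ≈-trans (reflexive (pickSum-map f _ xs)) (pickSum-cong xs (λ _ → permSum-map m f _ _))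

  permSum-0 : ∀ m {W : List A → Carrier} xs → length xs ≡ m →
              (∀ w → w ↭ xs → W w ≈ 0#) → permSum m W xs ≈ 0#
  permSum-0 zero    [] _ e = e [] ↭-refl
  permSum-0 (suc m) xs l e = ≈-trans
    (pickSum-cong xs λ {y} i →
      permSum-0 m _ (Pick-length i l) (λ w p → e (y ∷ w) (↭-trans (prep y p) (Pick⇒↭ i))))
    (pickSum-0 xs)

  ℕ→K-+ : ∀ m n → ℕ→K (m ℕ.+ n) ≈ ℕ→K m + ℕ→K n
  ℕ→K-+ zero    n = sym (+-identityˡ _)
  ℕ→K-+ (suc m) n = ≈-trans (+-congˡ (ℕ→K-+ m n)) (sym (+-assoc _ _ _))

  ℕ→K-* : ∀ m n → ℕ→K (m ℕ.* n) ≈ ℕ→K m * ℕ→K n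
  ℕ→K-* zero    n = sym (zeroˡ _)
  ℕ→K-* (suc m) n = begin
    ℕ→K (n ℕ.+ m ℕ.* n)              ≈⟨ ℕ→K-+ n (m ℕ.* n) ⟩
    ℕ→K n + ℕ→K (m ℕ.* n)            ≈⟨ +-congˡ (ℕ→K-* m n) ⟩
    ℕ→K n + ℕ→K m * ℕ→K n            ≈⟨ solve 2 (λ a b → b :+ a :* b := (con ℤ.1ℤ :+ a) :* b) ≈-refl _ _ ⟩
    (1# + ℕ→K m) * ℕ→K n             ∎

  pickSum-constant : ∀ k (xs : List A) → pickSum (λ _ _ → k) xs ≈ ℕ→K (length xs) * k
  pickSum-constant k []       = sym (zeroˡ k)
  pickSum-constant k (x ∷ xs) = ≈-trans (+-congˡ (pickSum-constant k xs))
    (solve 2 (λ a b → b :+ a :* b := (con ℤ.1ℤ :+ a) :* b) ≈-refl _ _)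

  permSum-1 : ∀ m (xs : List A) → length xs ≡ m → permSum m (λ _ → 1#) xs ≈ ℕ→K (m !)
  permSum-1 zero    xs _ = sym (+-identityʳ 1#)
  permSum-1 (suc m) xs l = begin
    pickSum (λ _ r → permSum m (λ _ → 1#) r) xs  ≈⟨ pickSum-cong xs (λ i → permSum-1 m _ (Pick-length i l)) ⟩
    pickSum (λ _ _ → ℕ→K (m !)) xs               ≈⟨ pickSum-constant _ xs ⟩
    ℕ→K (length xs) * ℕ→K (m !)                  ≡⟨ ≡.cong (λ k → ℕ→K k * ℕ→K (m !)) l ⟩
    ℕ→K (suc m) * ℕ→K (m !)                      ≈⟨ ℕ→K-* (suc m) (m !) ⟨
    ℕ→K (suc m !)                                ∎

  prodL-map-↭ : ∀ (f : A → Carrier) {xs ys} → xs ↭ ys → prodL (map f xs) ≈ prodL (map f ys)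
  prodL-map-↭ f _↭_.refl         = ≈-refl
  prodL-map-↭ f (prep x p)   = *-congˡ (prodL-map-↭ f p)
  prodL-map-↭ f (swap x y p) = ≈-trans (*-congˡ (*-congˡ (prodL-map-↭ f p)))
    (solve 3 (λ a b c → a :* (b :* c) := b :* (a :* c)) ≈-refl _ _ _)
  prodL-map-↭ f (_↭_.trans p q)  = ≈-trans (prodL-map-↭ f p) (prodL-map-↭ f q)

-- Expansion of Pf_λ, and the recursion for the P-function.

indices : List A → List A → List B → List (A ⊎ B)
indices ts xs es = map inj₁ xs ++ (map inj₁ ts ++ map inj₂ (reverse es))

indices-∷ : ∀ (ts xs : List A) (e : B) es → indices ts xs (e ∷ es) ≡ indices ts xs es ∷ʳ inj₂ e
indices-∷ ts xs e es = begin
  map inj₁ xs ++ (map inj₁ ts ++ map inj₂ (reverse (e ∷ es)))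
    ≡⟨ ≡.cong (λ l → map inj₁ xs ++ (map inj₁ ts ++ map inj₂ l)) (Listₚ.unfold-reverse e es) ⟩
  map inj₁ xs ++ (map inj₁ ts ++ map inj₂ (reverse es ∷ʳ e))
    ≡⟨ ≡.cong (λ l → map inj₁ xs ++ (map inj₁ ts ++ l)) (Listₚ.map-++ inj₂ (reverse es) _) ⟩
  map inj₁ xs ++ (map inj₁ ts ++ (map inj₂ (reverse es) ∷ʳ inj₂ e))
    ≡⟨ ≡.cong (map inj₁ xs ++_) (Listₚ.++-assoc (map inj₁ ts) _ _) ⟨
  map inj₁ xs ++ ((map inj₁ ts ++ map inj₂ (reverse es)) ∷ʳ inj₂ e)
    ≡⟨ Listₚ.++-assoc (map inj₁ xs) _ _ ⟨
  indices ts xs es ∷ʳ inj₂ e ∎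
  where open ≡.≡-Reasoning

length-indices : ∀ (ts xs : List A) (es : List B) →
                 length (indices ts xs es) ≡ length xs ℕ.+ (length ts ℕ.+ length es)
length-indices {A = A} {B = B} ts xs es
  rewrite Listₚ.length-++ (map (inj₁ {B = B}) xs) {map inj₁ ts ++ map inj₂ (reverse es)}
        | Listₚ.length-++ (map (inj₁ {B = B}) ts) {map inj₂ (reverse es)}
        | Listₚ.length-map (inj₁ {B = B}) xs | Listₚ.length-map (inj₁ {B = B}) ts
        | Listₚ.length-map (inj₂ {A = A}) (reverse es) | Listₚ.length-reverse es = ≡.refl

module Nimmo {c ℓ} (F : CharZeroField c ℓ) (a : ℕ → CharZeroField.Carrier F) where
  open CharZeroField F renaming (refl to ≈-refl; trans to ≈-trans) hiding (zero)
  open FieldDefs F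
  open IntegerSolver commutativeRing
  open Sums F
  open Schur F
  open PermutationSums F
  open import Relation.Binary.Reasoning.Setoid setoid

  -- `inj₁ u` labels the row of a variable, `inj₂ e` the column of B with exponent `e`. With labels
  -- in place of positions, deleting rows and columns leaves the entries untouched.
  entry : Carrier ⊎ ℕ → Carrier ⊎ ℕ → Carrier
  entry (inj₁ u) (inj₁ v) = quot u v
  entry (inj₁ u) (inj₂ e) = fpow a u e
  entry (inj₂ e) (inj₁ v) = - fpow a v e
  entry (inj₂ _) (inj₂ _) = 0#

  -- The recursion for P_λ taken as a definition, with no factorial to divide out; `es` lists the
  -- parts with the largest first.
  schurSum : List ℕ → List Carrier → Carrier
  schurSum []       xs = 1#
  schurSum (e ∷ es) xs = pickSum (λ y r → fpow a y e * schurSum es r * row⁻ y r) xs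

  fpow-0 : a 1 ≈ 0# → ∀ {e} → 0 ℕ.< e → fpow a 0# e ≈ 0#
  fpow-0 a₁ {suc zero} _ = begin
    1# * (0# - a 1)  ≈⟨ *-congˡ (+-congˡ (-‿cong a₁)) ⟩
    1# * (0# - 0#)   ≈⟨ solve 0 (con ℤ.1ℤ :* (con ℤ.0ℤ :- con ℤ.0ℤ) := con ℤ.0ℤ) ≈-refl ⟩
    0#               ∎
  fpow-0 a₁ {suc (suc e)} _ = ≈-trans (*-congʳ (fpow-0 a₁ {suc e} (ℕ.s≤s ℕ.z≤n))) (zeroˡ _)

  -- `ts` is `[]` or `0# ∷ []`, according to the parity of n + l. Each expansion step uses up one
  -- variable and one column, so at the end the length of `xs ++ ts` is even and `pf-base` is
  -- Schur's evaluation.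
  module _ (ts : List Carrier)
           (vanish : ∀ {e} → 0 ℕ.< e → All (λ t → fpow a t e ≈ 0#) ts)
           (pf-base : ∀ k {xs} → AllPairs Generic xs → All _≉0 xs → length (xs ++ ts) ≡ double k →
                      pf k quot (xs ++ ts) ≈ disc xs)
           where

    -- Induction on the parts: the first of them, `e`, labels the last column. Its entries vanish at
    -- `ts` and at the other columns of B, so only the variables survive, and `altSum-disc` rebuilds
    -- the recursion.
    pf-entry : ∀ k {xs es} → AllPairs Generic xs → All _≉0 xs → All (0 ℕ.<_) es →
               length (indices ts xs es) ≡ double k →
               pf k entry (indices ts xs es) ≈ disc xs * schurSum es xs
    pf-entry k {xs} {[]} gs zs [] l = begin
      pf k entry (map inj₁ xs ++ (map inj₁ ts ++ []))
        ≡⟨ ≡.cong (pf k entry) eq ⟩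
      pf k entry (map inj₁ (xs ++ ts))
        ≈⟨ pf-map k inj₁ (λ _ _ → ≈-refl) (xs ++ ts) ⟨
      pf k quot (xs ++ ts)
        ≈⟨ pf-base k gs zs (≡.trans (≡.sym (Listₚ.length-map inj₁ (xs ++ ts))) (≡.trans (≡.cong length (≡.sym eq)) l)) ⟩
      disc xs
        ≈⟨ *-identityʳ _ ⟨
      disc xs * 1# ∎
      where
      eq : indices ts xs [] ≡ map inj₁ (xs ++ ts)
      eq = ≡.trans (≡.cong (map inj₁ xs ++_) (Listₚ.++-identityʳ _)) (≡.sym (Listₚ.map-++ inj₁ xs ts))
    -- The equation `double k ≡ suc …` obtained here excludes `k = zero`.
    pf-entry k {xs} {e ∷ es} gs zs (p ∷ ps) l with ≡.trans (≡.sym l) (≡.trans (≡.cong length (indices-∷ ts xs e es))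
                                                       (≡.trans (Listₚ.length-++ (indices ts xs es)) (ℕₚ.+-comm _ 1)))
    pf-entry (suc k) {xs} {e ∷ es} gs zs (p ∷ ps) l | l′ = begin
      pf (suc k) entry (indices ts xs (e ∷ es))
        ≡⟨ ≡.cong (pf (suc k) entry) (indices-∷ ts xs e es) ⟩
      pf (suc k) entry (indices ts xs es ∷ʳ inj₂ e)
        ≈⟨ pf-∷ʳ k entry (indices ts xs es) (inj₂ e) odd ⟩
      altSum (λ y r → entry y (inj₂ e) * pf k entry r) (indices ts xs es)
        ≈⟨ altSum-++-0 _ (map inj₁ xs) zeros ⟩
      altSum (λ y r → entry y (inj₂ e) * pf k entry (r ++ (map inj₁ ts ++ map inj₂ (reverse es)))) (map inj₁ xs)
        ≡⟨ altSum-map inj₁ _ xs ⟩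
      altSum (λ y r → fpow a y e * pf k entry (indices ts r es)) xs
        ≈⟨ altSum-cong xs (λ {y} {r} i → ≈-trans
             (*-congˡ (pf-entry k (proj₂ (Pick-AllPairs Generic-sym i gs)) (proj₂ (Pick-All i zs)) ps
               (≡.trans (length-indices ts r es) (ℕₚ.suc-injective
                 (≡.trans (≡.cong (ℕ._+ _) (≡.sym (Pick-length-suc i)))
                          (≡.trans (≡.sym (length-indices ts xs es)) odd))))))
             (solve 3 (λ a b c → a :* (b :* c) := a :* c :* b) ≈-refl _ _ _)) ⟩
      altSum (λ y r → fpow a y e * schurSum es r * disc r) xs
        ≈⟨ altSum-disc _ gs ⟩
      disc xs * schurSum (e ∷ es) xs ∎
      where
      odd : length (indices ts xs es) ≡ suc (double k)
      odd = ≡.sym (ℕₚ.suc-injective l′)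
      zeros : All (λ t → ∀ r → entry t (inj₂ e) * pf k entry r ≈ 0#) (map inj₁ ts ++ map inj₂ (reverse es))
      zeros = Allₚ.++⁺
        (Allₚ.map⁺ (All.map (λ z _ → ≈-trans (*-congʳ z) (zeroˡ _)) (vanish p)))
        (Allₚ.map⁺ (All.universal (λ _ _ → zeroˡ _) (reverse es)))

  -- The summand of P_{λ;a} as a function of the word x_{ω(1)} … x_{ω(n)}.
  weight : List ℕ → List Carrier → Carrier
  weight []       xs       = 1#
  weight (e ∷ es) []       = 0#
  weight (e ∷ es) (x ∷ xs) = fpow a x e * row⁻ x xs * weight es xs

  -- `row⁻ y` depends on the letters after `y` only up to order, so it leaves the sum over their
  -- orderings. Once the parts are used up, every ordering of the `m ∸ length es` remaining letters
  -- has weight 1; this is the factorial divided out in the P-function.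
  permSum-weight : ∀ m es xs → length xs ≡ m → length es ℕ.≤ m →
                   permSum m (weight es) xs ≈ ℕ→K ((m ∸ length es) !) * schurSum es xs
  permSum-weight m [] xs l _ = ≈-trans (permSum-1 m xs l) (sym (*-identityʳ _))
  permSum-weight (suc m) (e ∷ es) xs l (ℕ.s≤s le) = begin
    pickSum (λ y r → permSum m (λ w → fpow a y e * row⁻ y w * weight es w) r) xs
      ≈⟨ pickSum-cong xs (λ {y} {r} i → begin
           permSum m (λ w → fpow a y e * row⁻ y w * weight es w) r
             ≈⟨ permSum-cong m r (Pick-length i l) (λ w p → *-congʳ (*-congˡ (prodL-map-↭ (quot⁻ y) p))) ⟩
           permSum m (λ w → fpow a y e * row⁻ y r * weight es w) r
             ≈⟨ permSum-* m _ _ r ⟩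
           fpow a y e * row⁻ y r * permSum m (weight es) r
             ≈⟨ *-congˡ (permSum-weight m es r (Pick-length i l) le) ⟩
           fpow a y e * row⁻ y r * (ℕ→K ((m ∸ length es) !) * schurSum es r)
             ≈⟨ solve 4 (λ a b c d → a :* b :* (c :* d) := c :* (a :* d :* b)) ≈-refl _ _ _ _ ⟩
           ℕ→K ((m ∸ length es) !) * (fpow a y e * schurSum es r * row⁻ y r) ∎) ⟩
    pickSum (λ y r → ℕ→K ((m ∸ length es) !) * (fpow a y e * schurSum es r * row⁻ y r)) xs
      ≈⟨ pickSum-* _ _ xs ⟩
    ℕ→K ((m ∸ length es) !) * schurSum (e ∷ es) xs ∎

-- Injective functions as words with distinct letters.

fresh : Fin n → List (Fin n) → Bool
fresh k = allB (λ c → not (k ==ᶠ c))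

distinct : List (Fin n) → Bool
distinct []      = true
distinct (k ∷ w) = fresh k w ∧ distinct w

∧-true : ∀ {x y} → x ∧ y ≡ true → x ≡ true × y ≡ true
∧-true {true} e = ≡.refl , e

allB-tabulate⁺ : ∀ {A : Set} (q : A → Bool) {n} (f : Fin n → A) →
                 (∀ i → q (f i) ≡ true) → allB q (tabulate f) ≡ true
allB-tabulate⁺ q {zero}  f e = ≡.refl
allB-tabulate⁺ q {suc n} f e rewrite e zero = allB-tabulate⁺ q (f ∘ suc) (e ∘ suc)

allB-tabulate⁻ : ∀ {A : Set} (q : A → Bool) {n} (f : Fin n → A) →
                 allB q (tabulate f) ≡ true → ∀ i → q (f i) ≡ true
allB-tabulate⁻ q {suc n} f e zero    = proj₁ (∧-true e)
allB-tabulate⁻ q {suc n} f e (suc i) = allB-tabulate⁻ q (f ∘ suc) (proj₂ (∧-true e)) i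

==ᶠ-false : ∀ {i j : Fin n} → i ≢ j → (i ==ᶠ j) ≡ false
==ᶠ-false {i = i} {j} = dec-false (i Finₚ.≟ j)

==ᶠ-true : ∀ {i j : Fin n} → i ≡ j → (i ==ᶠ j) ≡ true
==ᶠ-true {i = i} {j} = dec-true (i Finₚ.≟ j)

not-==ᶠ : ∀ {i j : Fin n} → not (i ==ᶠ j) ≡ true → i ≢ j
not-==ᶠ e i≡j rewrite ==ᶠ-true i≡j with () ← e

distinct-tabulate⁺ : ∀ {f : Fin m → Fin n} → (∀ {i j} → f i ≡ f j → i ≡ j) → distinct (tabulate f) ≡ true
distinct-tabulate⁺ {m = zero}  inj = ≡.refl
distinct-tabulate⁺ {m = suc m} {f = f} inj
  rewrite allB-tabulate⁺ (λ c → not (f zero ==ᶠ c)) (f ∘ suc)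
            (λ i → ≡.cong not (==ᶠ-false (λ e → Finₚ.0≢1+n (inj e))))
  = distinct-tabulate⁺ (λ e → Finₚ.suc-injective (inj e))

distinct-tabulate⁻ : ∀ {f : Fin m → Fin n} → distinct (tabulate f) ≡ true → ∀ {i j} → f i ≡ f j → i ≡ j
distinct-tabulate⁻ {m = suc m} {f = f} d {zero}  {zero}  e = ≡.refl
distinct-tabulate⁻ {m = suc m} {f = f} d {zero}  {suc j} e =
  contradiction e (not-==ᶠ (allB-tabulate⁻ _ (f ∘ suc) (proj₁ (∧-true d)) j))
distinct-tabulate⁻ {m = suc m} {f = f} d {suc i} {zero}  e =
  contradiction (≡.sym e) (not-==ᶠ (allB-tabulate⁻ _ (f ∘ suc) (proj₁ (∧-true d)) i))
distinct-tabulate⁻ {m = suc m} {f = f} d {suc i} {suc j} e =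
  ≡.cong suc (distinct-tabulate⁻ (proj₂ (∧-true {fresh (f zero) (tabulate (f ∘ suc))} d)) e)

-- The two Boolean tests are compared through the proposition that both decide. `distinct` recurses
-- along the word, as `permSum` does.
isInjective≡distinct : (f : Fin n → Fin n) → isInjective f ≡ distinct (tabulate f)
isInjective≡distinct f = Boolₚ.⇔→≡ (mk⇔
  (λ e → distinct-tabulate⁺ (λ {i} {j} → injective e i j))
  (λ d → allB-tabulate⁺ _ id (λ i → allB-tabulate⁺ _ id (λ j → checks (distinct-tabulate⁻ d) i j))))
  where
  injective : isInjective f ≡ true → ∀ i j → f i ≡ f j → i ≡ j
  injective e i j fi≡fj with i Finₚ.≟ j | allB-tabulate⁻ _ id (allB-tabulate⁻ _ id e i) j
  ... | yes i≡j | _ = i≡j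
  ... | no _    | r rewrite ==ᶠ-true fi≡fj with () ← r
  checks : (∀ {i j} → f i ≡ f j → i ≡ j) → ∀ i j → not (f i ==ᶠ f j) ∨ (i ==ᶠ j) ≡ true
  checks inj i j with f i Finₚ.≟ f j
  ... | no _  = ≡.refl
  ... | yes e = ==ᶠ-true (inj e)

-- From sums over functions to sums over orderings.

module WordSums {c ℓ} (F : CharZeroField c ℓ) where
  open CharZeroField F renaming (refl to ≈-refl; trans to ≈-trans)
  open FieldDefs F
  open IntegerSolver commutativeRing
  open Sums F
  open PermutationSums F
  open import Relation.Binary.Reasoning.Setoid setoid

  sumL-map-cong : ∀ {f g : A → Carrier} xs → All (λ x → f x ≈ g x) xs → sumL (map f xs) ≈ sumL (map g xs)
  sumL-map-cong []       []       = ≈-refl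
  sumL-map-cong (x ∷ xs) (e ∷ es) = +-cong e (sumL-map-cong xs es)

  sumL-map-0 : ∀ (xs : List A) → sumL (map (λ _ → 0#) xs) ≈ 0#
  sumL-map-0 []       = ≈-refl
  sumL-map-0 (x ∷ xs) = ≈-trans (+-identityˡ _) (sumL-map-0 xs)

  sumL-map-+ : ∀ (f g : A → Carrier) xs → sumL (map (λ x → f x + g x) xs) ≈ sumL (map f xs) + sumL (map g xs)
  sumL-map-+ f g []       = sym (+-identityˡ _)
  sumL-map-+ f g (x ∷ xs) = ≈-trans (+-congˡ (sumL-map-+ f g xs))
    (solve 4 (λ a b c d → (a :+ b) :+ (c :+ d) := (a :+ c) :+ (b :+ d)) ≈-refl _ _ _ _)

  sumL-map-↭ : ∀ (f : A → Carrier) {xs ys} → xs ↭ ys → sumL (map f xs) ≈ sumL (map f ys)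
  sumL-map-↭ f _↭_.refl         = ≈-refl
  sumL-map-↭ f (prep x p)   = +-congˡ (sumL-map-↭ f p)
  sumL-map-↭ f (swap x y p) = ≈-trans (+-congˡ (+-congˡ (sumL-map-↭ f p)))
    (solve 3 (λ a b c → a :+ (b :+ c) := b :+ (a :+ c)) ≈-refl _ _ _)
  sumL-map-↭ f (_↭_.trans p q)  = ≈-trans (sumL-map-↭ f p) (sumL-map-↭ f q)

  sumL-++ : ∀ xs ys → sumL (xs ++ ys) ≈ sumL xs + sumL ys
  sumL-++ []       ys = sym (+-identityˡ _)
  sumL-++ (x ∷ xs) ys = ≈-trans (+-congˡ (sumL-++ xs ys)) (sym (+-assoc _ _ _))

  sumL-map-concatMap : ∀ (f : B → Carrier) (g : A → List B) xs →
                       sumL (map f (concatMap g xs)) ≈ sumL (map (λ x → sumL (map f (g x))) xs)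
  sumL-map-concatMap f g []       = ≈-refl
  sumL-map-concatMap f g (x ∷ xs) = begin
    sumL (map f (g x ++ concatMap g xs))                      ≡⟨ ≡.cong sumL (Listₚ.map-++ f (g x) _) ⟩
    sumL (map f (g x) ++ map f (concatMap g xs))              ≈⟨ sumL-++ (map f (g x)) _ ⟩
    sumL (map f (g x)) + sumL (map f (concatMap g xs))        ≈⟨ +-congˡ (sumL-map-concatMap f g xs) ⟩
    sumL (map f (g x)) + sumL (map (λ x → sumL (map f (g x))) xs) ∎

  sumL-map-filterᵇ : ∀ (f : A → Carrier) q xs →
                     sumL (map f (filterᵇ q xs)) ≈ sumL (map (λ x → if q x then f x else 0#) xs)
  sumL-map-filterᵇ f q [] = ≈-refl
  sumL-map-filterᵇ f q (x ∷ xs) with q x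
  ... | true  = +-congˡ (sumL-map-filterᵇ f q xs)
  ... | false = ≈-trans (sumL-map-filterᵇ f q xs) (sym (+-identityˡ _))

  wordSum : ℕ → List A → (List A → Carrier) → Carrier
  wordSum zero    xs W = W []
  wordSum (suc m) xs W = sumL (map (λ c → wordSum m xs (λ w → W (c ∷ w))) xs)

  wordSum-cong : ∀ m (xs : List A) {V W : List A → Carrier} → (∀ w → V w ≈ W w) →
                 wordSum m xs V ≈ wordSum m xs W
  wordSum-cong zero    xs e = e []
  wordSum-cong (suc m) xs e = sumL-map-cong xs (All.universal (λ c → wordSum-cong m xs (λ w → e (c ∷ w))) xs)

  wordSum-0 : ∀ m (xs : List A) → wordSum m xs (λ _ → 0#) ≈ 0#
  wordSum-0 zero    xs = ≈-refl
  wordSum-0 (suc m) xs = ≈-trans (sumL-map-cong xs (All.universal (λ _ → wordSum-0 m xs) xs)) (sumL-map-0 xs)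

  wordSum-+ : ∀ m (xs : List A) (V W : List A → Carrier) →
              wordSum m xs (λ w → V w + W w) ≈ wordSum m xs V + wordSum m xs W
  wordSum-+ zero    xs V W = ≈-refl
  wordSum-+ (suc m) xs V W =
    ≈-trans (sumL-map-cong xs (All.universal (λ _ → wordSum-+ m xs _ _) xs)) (sumL-map-+ _ _ xs)

  wordSum-↭ : ∀ m {xs ys : List A} (W : List A → Carrier) → xs ↭ ys → wordSum m xs W ≈ wordSum m ys W
  wordSum-↭ zero    W p = ≈-refl
  wordSum-↭ (suc m) {xs} {ys} W p =
    ≈-trans (sumL-map-cong xs (All.universal (λ _ → wordSum-↭ m _ p) xs)) (sumL-map-↭ _ p)

  wordSum-sumL : ∀ m (xs : List A) (W : B → List A → Carrier) ks →
                 wordSum m xs (λ w → sumL (map (λ k → W k w) ks)) ≈ sumL (map (λ k → wordSum m xs (W k)) ks)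
  wordSum-sumL m xs W []       = wordSum-0 m xs
  wordSum-sumL m xs W (k ∷ ks) = ≈-trans (wordSum-+ m xs _ _) (+-congˡ (wordSum-sumL m xs W ks))

  -- `allMaps` runs over the tails of words in its outer loop and over their heads in its inner one,
  -- `wordSum` the other way round; `wordSum-sumL` exchanges the two sums.
  sumL-allMaps : ∀ m n (W : List (Fin n) → Carrier) →
                 sumL (map (W ∘ tabulate) (allMaps m n)) ≈ wordSum m (allFin n) W
  sumL-allMaps zero    n W = +-identityʳ _
  sumL-allMaps (suc m) n W = begin
    sumL (map (W ∘ tabulate) (allMaps (suc m) n))
      ≈⟨ sumL-map-concatMap (W ∘ tabulate) _ (allMaps m n) ⟩
    sumL (map (λ f → sumL (map (W ∘ tabulate) (map _ (allFin n)))) (allMaps m n))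
      ≈⟨ sumL-map-cong (allMaps m n) (All.universal (λ f → reflexive (≡.cong sumL (≡.sym (Listₚ.map-∘ (allFin n))))) _) ⟩
    sumL (map (λ f → sumL (map (λ k → W (k ∷ tabulate f)) (allFin n))) (allMaps m n))
      ≈⟨ sumL-allMaps m n (λ w → sumL (map (λ k → W (k ∷ w)) (allFin n))) ⟩
    wordSum m (allFin n) (λ w → sumL (map (λ k → W (k ∷ w)) (allFin n)))
      ≈⟨ wordSum-sumL m (allFin n) _ (allFin n) ⟩
    wordSum (suc m) (allFin n) W ∎

  -- At each position the choice of `k` is killed by the test, and every letter of `r` passes it.
  wordSum-fresh : ∀ m {k : Fin n} {r} (G : List (Fin n) → Carrier) → All (k ≢_) r →
                  wordSum m (k ∷ r) (λ w → if fresh k w then G w else 0#) ≈ wordSum m r G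
  wordSum-fresh zero    G ks = ≈-refl
  wordSum-fresh (suc m) {k} {r} G ks = begin
    wordSum m (k ∷ r) (λ w → if fresh k (k ∷ w) then G (k ∷ w) else 0#) + _
      ≈⟨ +-cong
          (≈-trans (wordSum-cong m (k ∷ r) (λ w → reflexive
              (≡.cong (λ b → if not b ∧ fresh k w then G (k ∷ w) else 0#) (==ᶠ-true {i = k} ≡.refl))))
                   (wordSum-0 m (k ∷ r)))
          (sumL-map-cong r (All.map (λ {c} k≢c → ≈-trans
             (wordSum-cong m (k ∷ r) (λ w → reflexive
               (≡.cong (λ b → if not b ∧ fresh k w then G (c ∷ w) else 0#) (==ᶠ-false k≢c))))
             (wordSum-fresh m (λ w → G (c ∷ w)) ks)) ks)) ⟩
    0# + wordSum (suc m) r G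
      ≈⟨ +-identityˡ _ ⟩
    wordSum (suc m) r G ∎

  if-∧ : ∀ x y {u : Carrier} → (if x ∧ y then u else 0#) ≡ (if x then (if y then u else 0#) else 0#)
  if-∧ true  y = ≡.refl
  if-∧ false y = ≡.refl

  -- The test that `k` does not recur is traded for an alphabet without `k`, which is the recursion
  -- of `permSum`. A sum over all words ignores the order of its alphabet, so `k` may first be moved
  -- to the front.
  wordSum-distinct : ∀ m {xs : List (Fin n)} (W : List (Fin n) → Carrier) → Unique xs → length xs ≡ m →
                     wordSum m xs (λ w → if distinct w then W w else 0#) ≈ permSum m W xs
  wordSum-distinct zero    W u l = ≈-refl
  wordSum-distinct (suc m) {xs} W u l = begin
    sumL (map (λ k → wordSum m xs (λ w → if fresh k w ∧ distinct w then W (k ∷ w) else 0#)) xs)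
      ≈⟨ pickSum-const _ xs ⟨
    pickSum (λ k _ → wordSum m xs (λ w → if fresh k w ∧ distinct w then W (k ∷ w) else 0#)) xs
      ≈⟨ pickSum-cong xs (λ {k} {r} i → begin
           wordSum m xs (λ w → if fresh k w ∧ distinct w then W (k ∷ w) else 0#)
             ≈⟨ wordSum-cong m xs (λ w → reflexive (if-∧ (fresh k w) (distinct w))) ⟩
           wordSum m xs (λ w → if fresh k w then (if distinct w then W (k ∷ w) else 0#) else 0#)
             ≈⟨ wordSum-↭ m _ (Pick⇒↭ i) ⟨
           wordSum m (k ∷ r) (λ w → if fresh k w then (if distinct w then W (k ∷ w) else 0#) else 0#)
             ≈⟨ wordSum-fresh m _ (proj₁ (Pick-AllPairs ≡.≢-sym i u)) ⟩
           wordSum m r (λ w → if distinct w then W (k ∷ w) else 0#)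
             ≈⟨ wordSum-distinct m _ (proj₂ (Pick-AllPairs ≡.≢-sym i u)) (Pick-length i l) ⟩
           permSum m (λ w → W (k ∷ w)) r ∎) ⟩
    permSum (suc m) W xs ∎

  -- The passage from functions to words, used for the P-function and for the Pfaffian.
  sumL-perms : ∀ n {f : (Fin n → Fin n) → Carrier} (W : List (Fin n) → Carrier) →
               (∀ ω → f ω ≈ W (tabulate ω)) → sumL (map f (perms n)) ≈ permSum n W (allFin n)
  sumL-perms n {f} W e = begin
    sumL (map f (perms n))
      ≈⟨ sumL-map-filterᵇ f isInjective (allMaps n n) ⟩
    sumL (map (λ ω → if isInjective ω then f ω else 0#) (allMaps n n))
      ≈⟨ sumL-map-cong (allMaps n n) (All.universal eq _) ⟩
    sumL (map (λ ω → if distinct (tabulate ω) then W (tabulate ω) else 0#) (allMaps n n))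
      ≈⟨ sumL-allMaps n n (λ w → if distinct w then W w else 0#) ⟩
    wordSum n (allFin n) (λ w → if distinct w then W w else 0#)
      ≈⟨ wordSum-distinct n W (allFin⁺ n) (Listₚ.length-tabulate id) ⟩
    permSum n W (allFin n) ∎
    where
    eq : ∀ ω → (if isInjective ω then f ω else 0#) ≈ (if distinct (tabulate ω) then W (tabulate ω) else 0#)
    eq ω rewrite isInjective≡distinct ω with distinct (tabulate ω)
    ... | true  = e ω
    ... | false = ≈-refl

-- Inversions and the words admissible in a Pfaffian.

count : (A → Bool) → List A → ℕ
count q xs = length (filterᵇ q xs)

count-++ : ∀ (q : A → Bool) xs ys → count q (xs ++ ys) ≡ count q xs ℕ.+ count q ys
count-++ q []       ys = ≡.refl
count-++ q (x ∷ xs) ys with q x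
... | true  = ≡.cong suc (count-++ q xs ys)
... | false = count-++ q xs ys

count-map : ∀ (q : B → Bool) (f : A → B) xs → count q (map f xs) ≡ count (q ∘ f) xs
count-map q f []       = ≡.refl
count-map q f (x ∷ xs) with q (f x)
... | true  = ≡.cong suc (count-map q f xs)
... | false = count-map q f xs

count-tabulate : ∀ (q : A → Bool) (f : Fin n → A) → count q (tabulate f) ≡ count (q ∘ f) (allFin n)
count-tabulate q f = ≡.trans (≡.cong (count q) (≡.sym (Listₚ.map-tabulate id f))) (count-map q f (allFin _))

count-↭ : ∀ (q : A → Bool) {xs ys} → xs ↭ ys → count q xs ≡ count q ys
count-↭ q p = ↭-length (filter-↭ (T? ∘ q) p)

count-none : ∀ {q : A → Bool} {xs} → All (λ x → q x ≡ false) xs → count q xs ≡ 0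
count-none []       = ≡.refl
count-none (e ∷ es) rewrite e = count-none es

count-cartesianProduct : ∀ (q : A × B → Bool) xs ys →
  count q (cartesianProduct xs ys) ≡ sum (map (λ x → count (λ y → q (x , y)) ys) xs)
count-cartesianProduct q []       ys = ≡.refl
count-cartesianProduct q (x ∷ xs) ys = ≡.trans (count-++ q (map (x ,_) ys) (cartesianProduct xs ys))
  (≡.cong₂ ℕ._+_ (count-map q (x ,_) ys) (count-cartesianProduct q xs ys))

inversionsOf : List (Fin n) → ℕ
inversionsOf []      = 0
inversionsOf (k ∷ w) = count (_<ᶠ k) w ℕ.+ inversionsOf w

-- Domain and codomain have separate sizes because passing to `ω ∘ suc` shortens the domain only.
-- Position 0 is never counted as `j`, since no `i` lies below it.
sum-inversions : ∀ (ω : Fin m → Fin n) →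
  sum (map (λ i → count (λ j → (i <ᶠ j) ∧ (ω j <ᶠ ω i)) (allFin m)) (allFin m)) ≡ inversionsOf (tabulate ω)
sum-inversions {zero}  ω = ≡.refl
sum-inversions {suc m} ω = ≡.cong₂ ℕ._+_
  (≡.trans (count-tabulate (λ j → (zero {m} <ᶠ j) ∧ (ω j <ᶠ ω zero)) suc)
           (≡.sym (count-tabulate (_<ᶠ ω zero) (ω ∘ suc))))
  (≡.trans (≡.cong sum (≡.trans (Listₚ.map-tabulate suc h) (≡.sym (Listₚ.map-tabulate id (h ∘ suc)))))
    (≡.trans (≡.cong sum (Listₚ.map-cong (λ i → count-tabulate (λ j → (suc i <ᶠ j) ∧ (ω j <ᶠ ω (suc i))) suc) (allFin m)))
      (sum-inversions (ω ∘ suc))))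
  where
  h : Fin (suc m) → ℕ
  h i = count (λ j → (i <ᶠ j) ∧ (ω j <ᶠ ω i)) (allFin (suc m))

inversions≡inversionsOf : (ω : Fin n → Fin n) → inversions ω ≡ inversionsOf (tabulate ω)
inversions≡inversionsOf {n} ω = ≡.trans (count-cartesianProduct _ (allFin n) (allFin n)) (sum-inversions ω)

-- A Boolean equation, so that `rewrite` can evaluate the tests inside `admissible` and `count`.
_≺_ : Fin n → Fin n → Set
i ≺ j = (i <ᶠ j) ≡ true

<⇒≺ : ∀ {i j : Fin n} → toℕ i ℕ.< toℕ j → i ≺ j
<⇒≺ i<j = Equivalence.to Boolₚ.T-≡ (ℕₚ.<⇒<ᵇ i<j)

≺⇒< : ∀ {i j : Fin n} → i ≺ j → toℕ i ℕ.< toℕ j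
≺⇒< i≺j = ℕₚ.<ᵇ⇒< _ _ (Equivalence.from Boolₚ.T-≡ i≺j)

≺-trans : ∀ {i j k : Fin n} → i ≺ j → j ≺ k → i ≺ k
≺-trans {i = i} {j} {k} p q = <⇒≺ {i = i} {k} (ℕₚ.<-trans (≺⇒< {i = i} {j} p) (≺⇒< {i = j} {k} q))

≺-asym : ∀ {i j : Fin n} → i ≺ j → (j <ᶠ i) ≡ false
≺-asym {i = i} {j} p = Boolₚ.¬-not λ q → ℕₚ.<-asym (≺⇒< {i = i} {j} p) (≺⇒< {i = j} {i} q)

admissible : List (Fin n) → Bool
admissible w = allB (uncurry _<ᶠ_) (pairs w) ∧ firstsIncreasing (pairs w)

admissible-∷∷ : ∀ {a k : Fin n} {w} → a ≺ k → All (a ≺_) w → admissible (a ∷ k ∷ w) ≡ admissible w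
admissible-∷∷ a≺k []             rewrite a≺k = ≡.refl
admissible-∷∷ a≺k (_ ∷ [])       rewrite a≺k = ≡.refl
admissible-∷∷ a≺k (a≺c ∷ _ ∷ _)  rewrite a≺k | a≺c = ≡.refl

-- `k` lies below its partner `b` and below the head `c` of the next pair, and `c` lies below the
-- rest by induction.
admissible-head : ∀ j {k : Fin n} {w} → length w ≡ suc (double j) → admissible (k ∷ w) ≡ true → All (k ≺_) w
admissible-head zero    {k} {b ∷ []} l e = proj₁ (∧-true (proj₁ (∧-true e))) ∷ []
admissible-head (suc j) {k} {b ∷ c ∷ d ∷ w} l e
  with p , q ← ∧-true e
  with k≺b , p′ ← ∧-true {k <ᶠ b} p | k≺c , q′ ← ∧-true {k <ᶠ c} q =
  k≺b ∷ k≺c ∷ All.map (λ {z} → ≺-trans {i = k} {c} {z} k≺c)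
    (admissible-head j (ℕₚ.suc-injective (ℕₚ.suc-injective l)) (≡.cong₂ _∧_ p′ q′))

admissible-∌min : ∀ j {a k : Fin n} {w} → length w ≡ suc (double j) → a ≺ k → a ∈ w →
                  admissible (k ∷ w) ≡ false
admissible-∌min j {a} {k} l a≺k a∈w = Boolₚ.¬-not λ e →
  contradiction (≡.trans (≡.sym (All.lookup (admissible-head j l e) a∈w)) (≺-asym {i = a} {k} a≺k)) λ ()

-- The signed sum over admissible permutations as a first-row expansion.

module PfaffianSums {c ℓ} (F : CharZeroField c ℓ) where
  open CharZeroField F renaming (refl to ≈-refl; trans to ≈-trans)
  open FieldDefs F
  open IntegerSolver commutativeRing
  open Sums F
  open PermutationSums F
  open WordSums F
  open import Relation.Binary.Reasoning.Setoid setoid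

  sign-+ : ∀ i j → sign (i ℕ.+ j) ≈ sign i * sign j
  sign-+ zero    j = sym (*-identityˡ _)
  sign-+ (suc i) j = begin
    sign (suc (i ℕ.+ j))   ≈⟨ sign-suc (i ℕ.+ j) ⟩
    - sign (i ℕ.+ j)       ≈⟨ -‿cong (sign-+ i j) ⟩
    - (sign i * sign j)    ≈⟨ solve 2 (λ a b → :- (a :* b) := (:- a) :* b) ≈-refl _ _ ⟩
    - sign i * sign j      ≈⟨ *-congʳ (sign-suc i) ⟨
    sign (suc i) * sign j  ∎

  -- In an increasing list the letters below `y` are those ahead of it, so the parity of their
  -- number is the alternating sign of its position.
  pickSum-sign : ∀ (G : Fin n → List (Fin n) → Carrier) {xs} → AllPairs _≺_ xs →
                 pickSum (λ y r → sign (count (_<ᶠ y) r) * G y r) xs ≈ altSum G xs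
  pickSum-sign G []       = ≈-refl
  pickSum-sign G {x ∷ xs} (s ∷ ss) = +-cong
    (≈-trans (*-congʳ (reflexive (≡.cong sign (count-none (All.map (λ {y} → ≺-asym {i = x} {y}) s))))) (*-identityˡ _))
    (begin
      pickSum (λ y r → sign (count (_<ᶠ y) (x ∷ r)) * G y (x ∷ r)) xs
        ≈⟨ pickSum-cong xs (λ {y} {r} i → ≈-trans
             (*-congʳ (≈-trans (reflexive (≡.cong sign (count-x y r (proj₁ (Pick-All i s))))) (sign-suc (count (_<ᶠ y) r))))
             (solve 2 (λ a b → :- a :* b := (:- con ℤ.1ℤ) :* (a :* b)) ≈-refl _ _)) ⟩
      pickSum (λ y r → - 1# * (sign (count (_<ᶠ y) r) * G y (x ∷ r))) xs
        ≈⟨ pickSum-* _ _ xs ⟩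
      - 1# * pickSum (λ y r → sign (count (_<ᶠ y) r) * G y (x ∷ r)) xs
        ≈⟨ *-congˡ (pickSum-sign _ ss) ⟩
      - 1# * altSum (λ y r → G y (x ∷ r)) xs
        ≈⟨ solve 1 (λ a → (:- con ℤ.1ℤ) :* a := :- a) ≈-refl _ ⟩
      - altSum (λ y r → G y (x ∷ r)) xs ∎)
    where
    count-x : ∀ y r → x ≺ y → count (_<ᶠ y) (x ∷ r) ≡ suc (count (_<ᶠ y) r)
    count-x y r e rewrite e = ≡.refl

  module _ {N : ℕ} (M : Fin N → Fin N → Carrier) where

    signedProduct pfWeight : List (Fin N) → Carrier
    signedProduct w = sign (inversionsOf w) * prodL (map (uncurry M) (pairs w))
    pfWeight w = if admissible w then signedProduct w else 0#

    -- The least letter `x` in front creates no inversion, so besides those inside `w` only the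
    -- inversions of `y` count.
    pfWeight-∷∷ : ∀ {x y w} → x ≺ y → All (x ≺_) w →
                  pfWeight (x ∷ y ∷ w) ≈ sign (count (_<ᶠ y) w) * M x y * pfWeight w
    pfWeight-∷∷ {x} {y} {w} x≺y x≺w = ≈-trans
      (reflexive (≡.cong (λ b → if b then signedProduct (x ∷ y ∷ w) else 0#) (admissible-∷∷ x≺y x≺w)))
      (guarded (admissible w))
      where
      P = prodL (map (uncurry M) (pairs w))
      guarded : ∀ b → (if b then signedProduct (x ∷ y ∷ w) else 0#) ≈
                      sign (count (_<ᶠ y) w) * M x y * (if b then signedProduct w else 0#)
      guarded false = sym (zeroʳ _)
      guarded true  = begin
        sign (count (_<ᶠ x) (y ∷ w) ℕ.+ (count (_<ᶠ y) w ℕ.+ inversionsOf w)) * (M x y * P)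
          ≡⟨ ≡.cong (λ k → sign (k ℕ.+ (count (_<ᶠ y) w ℕ.+ inversionsOf w)) * (M x y * P))
               (count-none (All.map (λ {z} → ≺-asym {i = x} {z}) (x≺y ∷ x≺w))) ⟩
        sign (count (_<ᶠ y) w ℕ.+ inversionsOf w) * (M x y * P)
          ≈⟨ *-congʳ (sign-+ (count (_<ᶠ y) w) _) ⟩
        sign (count (_<ᶠ y) w) * sign (inversionsOf w) * (M x y * P)
          ≈⟨ solve 4 (λ a b c d → a :* b :* (c :* d) := a :* c :* (b :* d)) ≈-refl _ _ _ _ ⟩
        sign (count (_<ᶠ y) w) * M x y * signedProduct w ∎

    -- `x` is the least letter, so only words that begin with it survive. The second letter is its
    -- partner, and summing over that partner is the first-row expansion, with signs from
    -- `pickSum-sign`.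
    permSum-pfWeight : ∀ k {xs} → AllPairs _≺_ xs → length xs ≡ double k →
                       permSum (double k) pfWeight xs ≈ pf k M xs
    permSum-pfWeight zero    ss l = *-identityʳ 1#
    permSum-pfWeight (suc k) {x ∷ xs} (s ∷ ss) l = begin
      pickSum (λ y r → permSum (double k) (λ w → pfWeight (x ∷ y ∷ w)) r) xs
        + pickSum (λ y r → permSum (suc (double k)) (λ w → pfWeight (y ∷ w)) (x ∷ r)) xs
        ≈⟨ +-cong (pickSum-cong xs first) (≈-trans (pickSum-cong xs rest) (pickSum-0 xs)) ⟩
      pickSum (λ y r → sign (count (_<ᶠ y) r) * (M x y * pf k M r)) xs + 0#
        ≈⟨ +-identityʳ _ ⟩
      pickSum (λ y r → sign (count (_<ᶠ y) r) * (M x y * pf k M r)) xs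
        ≈⟨ pickSum-sign _ ss ⟩
      pf (suc k) M (x ∷ xs) ∎
      where
      l′ : length xs ≡ suc (double k)
      l′ = ℕₚ.suc-injective l
      -- `Pick-AllPairs` asks for a symmetric relation, which `_≺_` is not.
      sorted-rest : ∀ {y r xs} → Pick y r xs → AllPairs _≺_ xs → AllPairs _≺_ r
      sorted-rest here      (_ ∷ q) = q
      sorted-rest (there i) (p ∷ q) = proj₂ (Pick-All i p) ∷ sorted-rest i q
      first : ∀ {y r} → Pick y r xs →
              permSum (double k) (λ w → pfWeight (x ∷ y ∷ w)) r ≈ sign (count (_<ᶠ y) r) * (M x y * pf k M r)
      first {y} {r} i with x≺y , x≺r ← Pick-All i s = begin
        permSum (double k) (λ w → pfWeight (x ∷ y ∷ w)) r
          ≈⟨ permSum-cong (double k) r (Pick-length i l′) (λ w p → ≈-trans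
               (pfWeight-∷∷ x≺y (All-resp-↭ (↭-sym p) x≺r))
               (*-congʳ (*-congʳ (reflexive (≡.cong sign (count-↭ (_<ᶠ y) p)))))) ⟩
        permSum (double k) (λ w → sign (count (_<ᶠ y) r) * M x y * pfWeight w) r
          ≈⟨ permSum-* (double k) _ _ r ⟩
        sign (count (_<ᶠ y) r) * M x y * permSum (double k) pfWeight r
          ≈⟨ *-congˡ (permSum-pfWeight k (sorted-rest i ss) (Pick-length i l′)) ⟩
        sign (count (_<ᶠ y) r) * M x y * pf k M r
          ≈⟨ *-assoc _ _ _ ⟩
        sign (count (_<ᶠ y) r) * (M x y * pf k M r) ∎
      -- In an admissible word the first letter is the least one.
      rest : ∀ {y r} → Pick y r xs → permSum (suc (double k)) (λ w → pfWeight (y ∷ w)) (x ∷ r) ≈ 0#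
      rest {y} {r} i = permSum-0 (suc (double k)) (x ∷ r) lr (λ w p → reflexive
        (≡.cong (λ b → if b then signedProduct (y ∷ w) else 0#)
          (admissible-∌min k {x} {y} (≡.trans (↭-length p) lr) (proj₁ (Pick-All i s)) (∈-resp-↭ (↭-sym p) (here ≡.refl)))))
        where
        lr : length (x ∷ r) ≡ suc (double k)
        lr = ≡.cong suc (Pick-length i l′)

  Pf≈pf : ∀ k {N} (M : Fin N → Fin N → Carrier) → N ≡ double k → Pf N M ≈ pf k M (allFin N)
  Pf≈pf k {N} M ≡.refl = begin
    Pf N M
      ≈⟨ sumL-map-filterᵇ _ pfAdmissible (perms N) ⟩
    _ ≈⟨ sumL-perms N (pfWeight M) (λ ω → reflexive (≡.cong₂
           (λ w i → if admissible w then sign i * prodL (map (uncurry M) (pairs w)) else 0#)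
           (Listₚ.map-tabulate id ω) (inversions≡inversionsOf ω))) ⟩
    permSum N (pfWeight M) (allFin N)
      ≈⟨ permSum-pfWeight M k (AllPairsₚ.tabulate⁺-< (λ {i} {j} → <⇒≺ {i = i} {j})) (Listₚ.length-tabulate id) ⟩
    pf k M (allFin N) ∎

-- Tabulated lists and parity.

filterᵇ-map : ∀ (q : B → Bool) (f : A → B) xs → filterᵇ q (map f xs) ≡ map f (filterᵇ (q ∘ f) xs)
filterᵇ-map q f []       = ≡.refl
filterᵇ-map q f (x ∷ xs) with q (f x)
... | true  = ≡.cong (f x ∷_) (filterᵇ-map q f xs)
... | false = filterᵇ-map q f xs

allFin-suc : ∀ n → tabulate {A = Fin (suc n)} suc ≡ map suc (allFin n)
allFin-suc n = ≡.sym (Listₚ.map-tabulate id suc)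

filterᵇ-tabulate-suc : ∀ (q : Fin (suc n) → Bool) →
                       filterᵇ q (tabulate suc) ≡ map suc (filterᵇ (q ∘ suc) (allFin n))
filterᵇ-tabulate-suc q = ≡.trans (≡.cong (filterᵇ q) (allFin-suc _)) (filterᵇ-map q suc (allFin _))

filterᵇ-true : ∀ (xs : List A) → filterᵇ (λ _ → true) xs ≡ xs
filterᵇ-true []       = ≡.refl
filterᵇ-true (x ∷ xs) = ≡.cong (x ∷_) (filterᵇ-true xs)

tabulate-splitAt : ∀ m {n} (f : Fin m → A) (g : Fin n → A) →
                   tabulate (λ i → [ f , g ]′ (splitAt m i)) ≡ tabulate f ++ tabulate g
tabulate-splitAt zero    f g = ≡.refl
tabulate-splitAt (suc m) f g = ≡.cong (f zero ∷_)
  (≡.trans (Listₚ.tabulate-cong (λ i → [,]-map (splitAt m i))) (tabulate-splitAt m (f ∘ suc) g))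

tabulate-∷ʳ : ∀ (f : Fin (suc n) → A) → tabulate f ≡ tabulate (f ∘ inject₁) ∷ʳ f (fromℕ n)
tabulate-∷ʳ {n = zero}  f = ≡.refl
tabulate-∷ʳ {n = suc n} f = ≡.cong (f zero ∷_) (tabulate-∷ʳ (f ∘ suc))

-- It turns the index l + 1 - j of the columns of B into the reversed list of parts used by
-- `indices`.
tabulate-opposite : ∀ (f : Fin n → A) → tabulate (f ∘ opposite) ≡ reverse (tabulate f)
tabulate-opposite {n = zero}  f = ≡.refl
tabulate-opposite {n = suc n} f = begin
  f (fromℕ n) ∷ tabulate (f ∘ inject₁ ∘ opposite)   ≡⟨ ≡.cong (f (fromℕ n) ∷_) (tabulate-opposite (f ∘ inject₁)) ⟩
  f (fromℕ n) ∷ reverse (tabulate (f ∘ inject₁))    ≡⟨ Listₚ.reverse-++ (tabulate (f ∘ inject₁)) (f (fromℕ n) ∷ []) ⟨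
  reverse (tabulate (f ∘ inject₁) ∷ʳ f (fromℕ n))   ≡⟨ ≡.cong reverse (tabulate-∷ʳ f) ⟨
  reverse (tabulate f)                              ∎
  where open ≡.≡-Reasoning

-- Indexed by the Boolean as well, so that one match settles both the `if` in the definitions of the
-- two Pfaffians and the shape of the size.
data Parity : ℕ → Bool → Set where
  even : ∀ k → Parity (double k) true
  odd  : ∀ k → Parity (suc (double k)) false

parity : ∀ n → Parity n (isEven n)
parity zero          = even 0
parity (suc zero)    = odd 0
parity (suc (suc n)) with isEven n | parity n
... | _ | even k = even (suc k)
... | _ | odd k  = odd (suc k)

-- Both sides of the identity at a point in general position.

module Theorem {c ℓ} (F : CharZeroField c ℓ) (a : ℕ → CharZeroField.Carrier F)
               (a₁≈0 : CharZeroField._≈_ F (a 1) (CharZeroField.0# F))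
               {l} (λ′ : Fin l → ℕ) (strict : IsStrictPartition λ′) where
  open CharZeroField F renaming (refl to ≈-refl; trans to ≈-trans) hiding (zero)
  open FieldDefs F
  open IntegerSolver commutativeRing
  open Sums F
  open Schur F
  open PermutationSums F
  open WordSums F
  open PfaffianSums F
  open Nimmo F a
  open import Relation.Binary.Reasoning.Setoid setoid

  !-≉0 : ∀ k → ℕ→K (k !) ≉0
  !-≉0 k with k ! | ℕₚ.1≤n! k
  ... | suc j | _ = charZero j

  parts : List ℕ
  parts = tabulate λ′

  parts-positive : All (0 ℕ.<_) parts
  parts-positive = Allₚ.tabulate⁺ (proj₂ strict)

  tabulate-append0 : ∀ {n} (x : Fin n → Carrier) → tabulate (append0 x) ≡ tabulate x ∷ʳ 0#
  tabulate-append0 {zero}  x = ≡.refl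
  tabulate-append0 {suc n} x = ≡.cong (x zero ∷_) (tabulate-append0 (x ∘ suc))

  -- On the diagonal the numerator is 0, so `quot` agrees with `A0` whatever value `_⁻¹` takes, in
  -- particular at the appended variable, where the denominator is 0 as well.
  A0≈quot : ∀ {n} (x : Fin n → Carrier) i j → A0 x i j ≈ quot (x i) (x j)
  A0≈quot x i j with i Finₚ.≟ j
  ... | no _       = ≈-refl
  ... | yes ≡.refl = sym (≈-trans (*-congʳ (-‿inverseʳ (x i))) (zeroˡ _))

  Pf-A0 : ∀ k {n} (x : Fin n → Carrier) → n ≡ double k → Pf n (A0 x) ≈ pf k quot (tabulate x)
  Pf-A0 k {n} x e = begin
    Pf n (A0 x)                      ≈⟨ Pf≈pf k (A0 x) e ⟩
    pf k (A0 x) (allFin n)           ≈⟨ pf-map k x (A0≈quot x) (allFin n) ⟩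
    pf k quot (map x (allFin n))     ≡⟨ ≡.cong (pf k quot) (Listₚ.map-tabulate id x) ⟩
    pf k quot (tabulate x)           ∎

  index : ∀ {n} → (Fin n → Carrier) → Fin (n ℕ.+ l) → Carrier ⊎ ℕ
  index {n} x p = [ inj₁ ∘ x , inj₂ ∘ λ′ ∘ opposite ]′ (splitAt n p)

  map-index : ∀ {n} (x : Fin n → Carrier) →
              map (index x) (allFin (n ℕ.+ l)) ≡ map inj₁ (tabulate x) ++ map inj₂ (reverse parts)
  map-index {n} x = ≡.trans (Listₚ.map-tabulate id (index x)) (≡.trans (tabulate-splitAt n _ _)
    (≡.cong₂ _++_ (≡.sym (Listₚ.map-tabulate x inj₁))
      (≡.trans (≡.sym (Listₚ.map-tabulate (λ′ ∘ opposite) inj₂)) (≡.cong (map inj₂) (tabulate-opposite λ′)))))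

  Aλ≈entry : ∀ {n} (x : Fin n → Carrier) p q → Aλ a λ′ n x p q ≈ entry (index x p) (index x q)
  Aλ≈entry {n} x p q with splitAt n p | splitAt n q
  ... | inj₁ i | inj₁ j = A0≈quot x i j
  ... | inj₁ i | inj₂ j = ≈-refl
  ... | inj₂ i | inj₁ j = ≈-refl
  ... | inj₂ i | inj₂ j = ≈-refl

  Pf-Aλ : ∀ k {n} (x : Fin n → Carrier) → n ℕ.+ l ≡ double k →
          Pf (n ℕ.+ l) (Aλ a λ′ n x) ≈ pf k entry (map inj₁ (tabulate x) ++ map inj₂ (reverse parts))
  Pf-Aλ k {n} x e = begin
    Pf (n ℕ.+ l) (Aλ a λ′ n x)                         ≈⟨ Pf≈pf k (Aλ a λ′ n x) e ⟩
    pf k (Aλ a λ′ n x) (allFin (n ℕ.+ l))              ≈⟨ pf-map k (index x) (Aλ≈entry x) (allFin _) ⟩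
    pf k entry (map (index x) (allFin (n ℕ.+ l)))      ≡⟨ ≡.cong (pf k entry) (map-index x) ⟩
    pf k entry (map inj₁ (tabulate x) ++ map inj₂ (reverse parts)) ∎

  -- At the first position the filter keeps all later letters; at later positions it drops position
  -- 0, so both sizes shrink by one.
  prodL-weight : ∀ {l n} (μ : Fin l → ℕ) (l≤n : l ℕ.≤ n) (y : Fin n → Carrier) →
    prodL (map (λ i → let ι = inject≤ i l≤n in
                      fpow a (y ι) (μ i) * prodL (map (λ j → quot⁻ (y ι) (y j)) (filterᵇ (λ j → ι <ᶠ j) (allFin n))))
               (allFin l))
    ≈ weight (tabulate μ) (tabulate y)
  prodL-weight {zero}          μ l≤n         y = ≈-refl
  prodL-weight {suc l} {suc n} μ (ℕ.s≤s l≤n) y = *-cong (*-congˡ (reflexive (≡.cong prodL head-row)))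
    (≈-trans (reflexive (≡.cong prodL tail-rows)) (prodL-weight (μ ∘ suc) l≤n (y ∘ suc)))
    where
    head-row : map (λ j → quot⁻ (y zero) (y j)) (filterᵇ (λ j → zero {n} <ᶠ j) (tabulate suc)) ≡
               map (quot⁻ (y zero)) (tabulate (y ∘ suc))
    head-row = ≡.trans (≡.cong (map _) (≡.trans (filterᵇ-tabulate-suc (λ j → zero {n} <ᶠ j))
                          (≡.cong (map suc) (filterᵇ-true (allFin n)))))
      (≡.trans (≡.cong (map _) (≡.sym (allFin-suc n)))
        (≡.trans (Listₚ.map-tabulate suc _) (≡.sym (Listₚ.map-tabulate (y ∘ suc) _))))
    tail-rows : map (λ i → let ι = inject≤ i (ℕ.s≤s l≤n) in
                      fpow a (y ι) (μ i) * prodL (map (λ j → quot⁻ (y ι) (y j)) (filterᵇ (λ j → ι <ᶠ j) (allFin (suc n)))))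
                    (tabulate suc)
              ≡ map (λ i → let ι = inject≤ i l≤n in
                      fpow a (y (suc ι)) (μ (suc i)) * prodL (map (λ j → quot⁻ (y (suc ι)) (y (suc j))) (filterᵇ (λ j → ι <ᶠ j) (allFin n))))
                    (allFin l)
    tail-rows = ≡.trans (≡.cong (map _) (allFin-suc l)) (≡.trans (≡.sym (Listₚ.map-∘ (allFin l)))
      (Listₚ.map-cong (λ i → let ι = inject≤ i l≤n in
        ≡.cong (λ ys → fpow a (y (suc ι)) (μ (suc i)) * prodL ys)
          (≡.trans (≡.cong (map _) (filterᵇ-tabulate-suc (λ j → suc ι <ᶠ j))) (≡.sym (Listₚ.map-∘ (filterᵇ (λ j → ι <ᶠ j) (allFin n))))))
        (allFin l)))

  -- An identity of rational functions is read at points of the field where no denominator vanishes.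
  -- Nonzero `x i` serve the appended variable and the partial fractions at t = 0.
  module _ (n : ℕ) (l≤n : l ℕ.≤ n) (x : Fin n → Carrier)
           (x-distinct : ∀ i j → i ≢ j → (x i - x j) ≉0)
           (x-sums : ∀ i j → i ≢ j → (x i + x j) ≉0)
           (x-nonzero : ∀ i → x i ≉0) where

    xs : List Carrier
    xs = tabulate x

    xs-generic : AllPairs Generic xs
    xs-generic = AllPairsₚ.tabulate⁺ (λ {i} {j} i≢j → x-distinct i j i≢j , x-sums i j i≢j)

    xs-nonzero : All _≉0 xs
    xs-nonzero = Allₚ.tabulate⁺ x-nonzero

    length-xs : length xs ≡ n
    length-xs = Listₚ.length-tabulate x

    pf-xs : ∀ k {xs} → AllPairs Generic xs → All _≉0 xs → length (xs ++ []) ≡ double k →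
            pf k quot (xs ++ []) ≈ disc xs
    pf-xs k {xs} gs zs e rewrite Listₚ.++-identityʳ xs = pf-quot-even k gs zs e

    pf-xs0 : ∀ k {xs} → AllPairs Generic xs → All _≉0 xs → length (xs ∷ʳ 0#) ≡ double k →
             pf k quot (xs ∷ʳ 0#) ≈ disc xs
    pf-xs0 k {xs} gs zs e with ≡.trans (≡.sym e) (≡.trans (Listₚ.length-++ xs) (ℕₚ.+-comm _ 1))
    pf-xs0 (suc k) {xs} gs zs e | e′ = pf-quot-odd k gs zs (≡.sym (ℕₚ.suc-injective e′))

    Pf₀≈disc : Pf₀ n x ≈ disc xs
    Pf₀≈disc with isEven n | parity n
    ... | _ | even k = ≈-trans (Pf-A0 k x ≡.refl) (pf-quot-even k xs-generic xs-nonzero length-xs)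
    ... | _ | odd k  = ≈-trans (Pf-A0 (suc k) (append0 x) ≡.refl)
      (≈-trans (reflexive (≡.cong (pf (suc k) quot) (tabulate-append0 x))) (pf-quot-odd k xs-generic xs-nonzero length-xs))

    Pfλ≈disc*schurSum : Pfλ a λ′ n x ≈ disc xs * schurSum parts xs
    -- `n ℕ.+ l` cannot be unified with `double k`, so the size is generalised to `N` together with
    -- an equation.
    Pfλ≈disc*schurSum = by-parity (isEven (n ℕ.+ l)) (parity (n ℕ.+ l)) ≡.refl
      where
      length-parts : length parts ≡ l
      length-parts = Listₚ.length-tabulate λ′
      by-parity : ∀ {N} b → Parity N b → N ≡ n ℕ.+ l →
        (if b then Pf (n ℕ.+ l) (Aλ a λ′ n x) else Pf (suc n ℕ.+ l) (Aλ a λ′ (suc n) (append0 x)))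
        ≈ disc xs * schurSum parts xs
      by-parity _ (even k) e = ≈-trans (Pf-Aλ k x (≡.sym e))
        (pf-entry [] (λ _ → []) pf-xs k xs-generic xs-nonzero parts-positive
          (≡.trans (length-indices [] xs parts) (≡.trans (≡.cong₂ ℕ._+_ length-xs length-parts) (≡.sym e))))
      by-parity _ (odd k) e = ≈-trans (Pf-Aλ (suc k) (append0 x) (≡.sym (≡.cong suc e)))
        (≈-trans (reflexive (≡.cong (pf (suc k) entry) eq))
        (pf-entry (0# ∷ []) (λ p → fpow-0 a₁≈0 p ∷ []) pf-xs0 (suc k) xs-generic xs-nonzero parts-positive
          (≡.trans (length-indices (0# ∷ []) xs parts) (≡.trans (≡.cong₂ (λ i j → i ℕ.+ suc j) length-xs length-parts)
            (≡.trans (ℕₚ.+-suc n l) (≡.cong suc (≡.sym e)))))))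
        where
        eq : map inj₁ (tabulate (append0 x)) ++ map inj₂ (reverse parts) ≡ indices (0# ∷ []) xs parts
        eq = ≡.trans (≡.cong (λ ys → map inj₁ ys ++ map inj₂ (reverse parts)) (tabulate-append0 x))
          (≡.trans (≡.cong (_++ map inj₂ (reverse parts)) (Listₚ.map-++ inj₁ xs (0# ∷ [])))
            (Listₚ.++-assoc (map inj₁ xs) _ _))

    SchurP≈schurSum : SchurP a λ′ n l≤n x ≈ schurSum parts xs
    SchurP≈schurSum = begin
      N! ⁻¹ * sumL (map _ (perms n))
        ≈⟨ *-congˡ (sumL-perms n (weight parts ∘ map x) (λ ω → ≈-trans (prodL-weight λ′ l≤n (x ∘ ω))
             (reflexive (≡.cong (weight parts) (≡.sym (Listₚ.map-tabulate ω x)))))) ⟩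
      N! ⁻¹ * permSum n (weight parts ∘ map x) (allFin n)
        ≈⟨ *-congˡ (≈-trans (sym (permSum-map n x (weight parts) (allFin n)))
             (reflexive (≡.cong (permSum n (weight parts)) (Listₚ.map-tabulate id x)))) ⟩
      N! ⁻¹ * permSum n (weight parts) xs
        ≈⟨ *-congˡ (permSum-weight n parts xs length-xs (≡.subst (ℕ._≤ n) (≡.sym length-parts) l≤n)) ⟩
      N! ⁻¹ * (ℕ→K ((n ∸ length parts) !) * schurSum parts xs)
        ≡⟨ ≡.cong (λ k → N! ⁻¹ * (ℕ→K ((n ∸ k) !) * schurSum parts xs)) length-parts ⟩
      N! ⁻¹ * (N! * schurSum parts xs)
        ≈⟨ solve 3 (λ a b c → a :* (b :* c) := b :* a :* c) ≈-refl _ _ _ ⟩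
      N! / N! * schurSum parts xs
        ≈⟨ *-congʳ (⁻¹-inverse N! (!-≉0 (n ∸ l))) ⟩
      1# * schurSum parts xs
        ≈⟨ *-identityˡ _ ⟩
      schurSum parts xs ∎
      where
      N! = ℕ→K ((n ∸ l) !)
      length-parts : length parts ≡ l
      length-parts = Listₚ.length-tabulate λ′

    -- `_⁻¹` is unconstrained at 0, so the quotient has a meaning only together with the first
    -- component, which holds because no factor of Schur's product vanishes at such a point.
    conclusion : ¬ (Pf₀ n x ≈ 0#) × (SchurP a λ′ n l≤n x ≈ Pfλ a λ′ n x / Pf₀ n x)
    conclusion = Pf₀≉0 , *≈⇒≈/ Pf₀≉0 (begin
      SchurP a λ′ n l≤n x * Pf₀ n x   ≈⟨ *-cong SchurP≈schurSum Pf₀≈disc ⟩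
      schurSum parts xs * disc xs     ≈⟨ *-comm _ _ ⟩
      disc xs * schurSum parts xs     ≈⟨ Pfλ≈disc*schurSum ⟨
      Pfλ a λ′ n x                    ∎)
      where
      Pf₀≉0 : Pf₀ n x ≉0
      Pf₀≉0 e = disc-≉0 xs-generic (≈-trans (sym Pf₀≈disc) e)

theorem3p2 : ∀ {c ℓ : Level} (F : CharZeroField c ℓ) →
    let open CharZeroField F
        open FieldDefs F
    in (a : ℕ → Carrier) → a 1 ≈ 0# →
       ∀ {l} (λ' : Fin l → ℕ) → IsStrictPartition λ' →
       (n : ℕ) (l≤n : l ≤ n) →
       (x : Fin n → Carrier) →
       (∀ i j → i ≢ j → ¬ (x i - x j ≈ 0#)) →
       (∀ i j → i ≢ j → ¬ (x i + x j ≈ 0#)) →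
       (∀ i → ¬ (x i ≈ 0#)) →
       ¬ (Pf₀ n x ≈ 0#) × (SchurP a λ' n l≤n x ≈ Pfλ a λ' n x / Pf₀ n x)
theorem3p2 F a a₁≈0 λ' strict n l≤n x = conclusion n l≤n x
  where open Theorem F a a₁≈0 λ' strict
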